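{- Let $N = q^k n^2$ be an odd perfect number given in Eulerian form. Then $$I(n) > \left(\frac{8}{5}\right)^{\frac{\ln(4/3)}{\ln(13/9)}} \approx 1.44440557.$$
   Context: For a positive integer $x$, $\sigma(x)$ denotes the sum of the positive divisors of $x$, and $I(x) = \sigma(x)/x$ is the abundancy index. A positive integer $N$ is perfect if $\sigma(N) = 2N$. An odd perfect number $N$ is said to be given in Eulerian form if $N = q^k n^2$ where $q$ is a prime, $q \equiv k \equiv 1 \pmod 4$, $n$ is a positive integer, and $\gcd(q,n) = 1$. -}

module Defs where

open import Algebra.Bundles using (CommutativeRing)
open import Data.Empty using (⊥)
open import Data.Integer.Base as ℤ using (+_; -[1+_])
import Data.Integer.Properties as ℤₚ
open import Data.List.Base using (List; []; _∷_; filter; foldr; map; applyUpTo; length; _++_)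
open import Data.List.Properties using (length-++)
open import Data.List.Relation.Unary.All using (All; []; _∷_)
open import Data.List.Relation.Unary.All.Properties using (++⁺)
open import Data.Nat.Base as ℕ using (ℕ; zero; suc)
import Data.Nat.Properties as ℕₚ
import Data.Nat.ListAction as ℕ
open import Data.Nat.Divisibility using (_∣?_)
open import Data.Nat.GCD using (gcd)
open import Data.Nat.Primality using (Prime)
open import Data.Product.Base using (proj₁; proj₂; Σ-syntax; ∃-syntax; _×_; _,_)
open import Data.Rational.Base
open import Data.Rational.Properties
open import Data.Rational.Solver using (module +-*-Solver)
import Data.Rational.Unnormalised.Base as ℚᵘ
import Data.Rational.Unnormalised.Properties as ℚᵘₚ
open import Data.Sum.Base as Sum using (_⊎_; inj₁; inj₂; [_,_]′)
open import Function.Base using (_∘_)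
open import Relation.Binary.Definitions using (Tri; tri<; tri≈; tri>)
open import Relation.Binary.PropositionalEquality
  using (_≡_; refl; sym; trans; cong; cong₂; subst; subst₂; module ≡-Reasoning)
open import Relation.Nullary using (yes; no; contradiction)
open import Relation.Nullary.Decidable using (from-yes)

open CommutativeRing +-*-commutativeRing using (semiring)
open import Algebra.Properties.Semiring.Exp semiring using (_^_; ^-assocʳ)
open +-*-Solver using (solve; _:=_; _:+_; _:*_; _:-_; con)

divisors : ℕ → List ℕ
divisors n = filter (_∣? n) (applyUpTo suc n)

σ : ℕ → ℕ
σ n = ℕ.sum (divisors n)

I : (n : ℕ) .{{_ : ℕ.NonZero n}} → ℚ
I n = + σ n / n

Perfect : ℕ → Set
Perfect N = σ N ≡ 2 ℕ.* N

OddPerfect : ℕ → Set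
OddPerfect N = N ℕ.% 2 ≡ 1 × Perfect N

record EulerianForm (N q k n : ℕ) : Set where
  field
    N≡qᵏn²  : N ≡ q ℕ.^ k ℕ.* n ℕ.^ 2
    q-prime : Prime q
    q%4≡1   : q ℕ.% 4 ≡ 1
    k%4≡1   : k ℕ.% 4 ≡ 1
    gcd≡1   : gcd q n ≡ 1

private
  variable
    p q r s : ℚ

≤-by : 0ℚ ≤ r → q ≡ p + r → p ≤ q
≤-by {r} {q} {p} 0≤r refl = subst (_≤ p + r) (+-identityʳ p) (+-monoʳ-≤ p 0≤r)

<-by : 0ℚ < r → q ≡ p + r → p < q
<-by {r} {q} {p} 0<r refl = subst (_< p + r) (+-identityʳ p) (+-monoʳ-< p 0<r)

0≤- : p ≤ q → 0ℚ ≤ q - p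
0≤- {p} {q} p≤q = subst (_≤ q - p) (+-inverseʳ p) (+-monoˡ-≤ (- p) p≤q)

0<- : p < q → 0ℚ < q - p
0<- {p} {q} p<q = subst (_< q - p) (+-inverseʳ p) (+-monoˡ-< (- p) p<q)

0≤* : 0ℚ ≤ p → 0ℚ ≤ q → 0ℚ ≤ p * q
0≤* {p} {q} 0≤p 0≤q =
  nonNegative⁻¹ (p * q) {{nonNeg*nonNeg⇒nonNeg p {{nonNegative 0≤p}} q {{nonNegative 0≤q}}}}

0<* : 0ℚ < p → 0ℚ < q → 0ℚ < p * q
0<* {p} {q} 0<p 0<q =
  positive⁻¹ (p * q) {{pos*pos⇒pos p {{positive 0<p}} q {{positive 0<q}}}}

0≤+ : 0ℚ ≤ p → 0ℚ ≤ q → 0ℚ ≤ p + q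
0≤+ = +-mono-≤ {0ℚ} {_} {0ℚ}

0≤² : ∀ p → 0ℚ ≤ p * p
0≤² p with ≤-total 0ℚ p
... | inj₁ 0≤p = 0≤* 0≤p 0≤p
... | inj₂ p≤0 = subst (0ℚ ≤_) (solve 1 (λ p → (con 0ℚ :- p) :* (con 0ℚ :- p) := p :* p) refl p)
                   (0≤* (0≤- p≤0) (0≤- p≤0))

0≤1 : 0ℚ ≤ 1ℚ
0≤1 = nonNegative⁻¹ 1ℚ

0<1 : 0ℚ < 1ℚ
0<1 = positive⁻¹ 1ℚ

*-monoʳ : 0ℚ ≤ r → p ≤ q → p * r ≤ q * r
*-monoʳ {r} 0≤r = *-monoʳ-≤-nonNeg r {{nonNegative 0≤r}}

*-monoˡ : 0ℚ ≤ r → p ≤ q → r * p ≤ r * q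
*-monoˡ {r} 0≤r = *-monoˡ-≤-nonNeg r {{nonNegative 0≤r}}

*-mono : 0ℚ ≤ p → 0ℚ ≤ s → p ≤ q → r ≤ s → p * r ≤ q * s
*-mono 0≤p 0≤s p≤q r≤s = ≤-trans (*-monoˡ 0≤p r≤s) (*-monoʳ 0≤s p≤q)

*-monoʳ-< : 0ℚ < r → p < q → p * r < q * r
*-monoʳ-< {r} 0<r = *-monoˡ-<-pos r {{positive 0<r}}

*-cancelʳ-< : 0ℚ ≤ r → p * r < q * r → p < q
*-cancelʳ-< {r} 0≤r = *-cancelʳ-<-nonNeg r {{nonNegative 0≤r}}

connex : ∀ p q → p < q ⊎ q ≤ p
connex p q with p <? q
... | yes p<q = inj₁ p<q
... | no  p≮q = inj₂ (≮⇒≥ p≮q)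

inverse : 0ℚ < p → ∃[ w ] 0ℚ < w × p * w ≡ 1ℚ
inverse {p} 0<p =
  (1/ p) , positive⁻¹ (1/ p) {{1/pos⇒pos p}} , *-inverseʳ p
  where instance
    _ = positive 0<p
    _ = pos⇒nonZero p

0≤^ : 0ℚ ≤ p → ∀ n → 0ℚ ≤ p ^ n
0≤^ 0≤p zero    = 0≤1
0≤^ 0≤p (suc n) = 0≤* 0≤p (0≤^ 0≤p n)

0<^ : 0ℚ < p → ∀ n → 0ℚ < p ^ n
0<^ 0<p zero    = 0<1
0<^ 0<p (suc n) = 0<* 0<p (0<^ 0<p n)

^-monoˡ : 0ℚ ≤ p → p ≤ q → ∀ n → p ^ n ≤ q ^ n
^-monoˡ 0≤p p≤q zero    = ≤-refl
^-monoˡ 0≤p p≤q (suc n) =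
  *-mono 0≤p (0≤^ (≤-trans 0≤p p≤q) n) p≤q (^-monoˡ 0≤p p≤q n)

^-monoˡ-< : 0ℚ ≤ p → p < q → ∀ n .{{_ : ℕ.NonZero n}} → p ^ n < q ^ n
^-monoˡ-< 0≤p p<q (suc n) = ≤-<-trans
  (*-monoˡ 0≤p (^-monoˡ 0≤p (<⇒≤ p<q) n))
  (*-monoʳ-< (0<^ (≤-<-trans 0≤p p<q) n) p<q)

1≤^ : 1ℚ ≤ p → ∀ n → 1ℚ ≤ p ^ n
1≤^ 1≤p zero    = ≤-refl
1≤^ 1≤p (suc n) = *-mono 0≤1 (0≤^ (≤-trans 0≤1 1≤p) n) 1≤p (1≤^ 1≤p n)

^-monoʳ : 1ℚ ≤ p → ∀ {m n} → m ℕ.≤ n → p ^ m ≤ p ^ n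
^-monoʳ 1≤p {n = n} ℕ.z≤n = 1≤^ 1≤p n
^-monoʳ 1≤p (ℕ.s≤s m≤n) = *-monoˡ (≤-trans 0≤1 1≤p) (^-monoʳ 1≤p m≤n)

ι : ℕ → ℚ
ι zero    = 0ℚ
ι (suc n) = 1ℚ + ι n

0≤ι : ∀ n → 0ℚ ≤ ι n
0≤ι zero    = ≤-refl
0≤ι (suc n) = 0≤+ 0≤1 (0≤ι n)

0<ι : ∀ n .{{_ : ℕ.NonZero n}} → 0ℚ < ι n
0<ι (suc n) = +-mono-<-≤ {0ℚ} 0<1 (0≤ι n)

ι-+ : ∀ m n → ι (m ℕ.+ n) ≡ ι m + ι n
ι-+ zero    n = sym (+-identityˡ _)
ι-+ (suc m) n = trans (cong (_+_ 1ℚ) (ι-+ m n)) (sym (+-assoc 1ℚ (ι m) (ι n)))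

ι-* : ∀ m n → ι (m ℕ.* n) ≡ ι m * ι n
ι-* zero    n = sym (*-zeroˡ (ι n))
ι-* (suc m) n = trans (ι-+ n (m ℕ.* n)) (trans (cong (_+_ (ι n)) (ι-* m n))
  (solve 2 (λ m n → n :+ m :* n := (con 1ℚ :+ m) :* n) refl (ι m) (ι n)))

ι-mono : ∀ {m n} → m ℕ.≤ n → ι m ≤ ι n
ι-mono {n = n} ℕ.z≤n = 0≤ι n
ι-mono (ℕ.s≤s m≤n)   = +-monoʳ-≤ 1ℚ (ι-mono m≤n)

ι-cancel-< : ∀ {m n} → ι m < ι n → m ℕ.< n
ι-cancel-< {m} {n} lt with m ℕₚ.<? n
... | yes m<n = m<n
... | no  m≮n = contradiction (<-≤-trans lt (ι-mono (ℕₚ.≮⇒≥ m≮n))) (<-irrefl refl)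

ι≃ : ∀ n → toℚᵘ (ι n) ℚᵘ.≃ ℚᵘ.mkℚᵘ (+ n) 0
ι≃ zero    = ℚᵘ.*≡* refl
ι≃ (suc n) = ℚᵘₚ.≃-trans (toℚᵘ-homo-+ 1ℚ (ι n))
  (ℚᵘₚ.≃-trans (ℚᵘₚ.+-congʳ ℚᵘ.1ℚᵘ (ι≃ n)) (ℚᵘ.*≡* (lem n)))
  where
  lem : ∀ n → (+ 1 ℤ.* + 1 ℤ.+ + n ℤ.* + 1) ℤ.* + 1 ≡ + (suc n) ℤ.* + 1
  lem n = cong (λ k → (+ 1 ℤ.+ k) ℤ.* + 1) (ℤₚ.*-identityʳ (+ n))

/-*-ι : ∀ i m .{{_ : ℕ.NonZero m}} → (+ i / m) * ι m ≡ ι i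
/-*-ι i m@(suc k) = toℚᵘ-injective
  (ℚᵘₚ.≃-trans (toℚᵘ-homo-* (+ i / m) (ι m))
  (ℚᵘₚ.≃-trans (ℚᵘₚ.*-cong (toℚᵘ-fromℚᵘ (ℚᵘ.mkℚᵘ (+ i) k)) (ι≃ m))
  (ℚᵘₚ.≃-trans (ℚᵘ.*≡* eq) (ℚᵘₚ.≃-sym (ι≃ i)))))
  where
  eq : + i ℤ.* + suc k ℤ.* + 1 ≡ + i ℤ.* + suc (k ℕ.* 1)
  eq = trans (ℤₚ.*-identityʳ (+ i ℤ.* + suc k))
             (cong (λ d → + i ℤ.* + suc d) (sym (ℕₚ.*-identityʳ k)))

archimedean : ∀ q → ∃[ n ] q < ι (suc n)
archimedean q@(mkℚ -[1+ _ ] _ _) = 0 , <-trans (negative⁻¹ q) (0<ι 1)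
archimedean q@(mkℚ (+ a) d-1 _)  = a , *-cancelʳ-< (<⇒≤ (0<ι d)) (begin-strict
  q * ι d             ≡⟨ cong (_* ι d) (↥p/↧p≡p q) ⟨
  + a / d * ι d       ≡⟨ /-*-ι a d ⟩
  ι a                 ≡⟨ +-identityˡ (ι a) ⟨
  0ℚ + ι a            <⟨ +-monoˡ-< (ι a) 0<1 ⟩
  ι (suc a)           ≡⟨ *-identityʳ (ι (suc a)) ⟨
  ι (suc a) * 1ℚ      ≤⟨ *-monoˡ (0≤ι (suc a)) (subst (_≤ ι d) (+-identityʳ 1ℚ) (ι-mono {1} {d} (ℕ.s≤s ℕ.z≤n))) ⟩
  ι (suc a) * ι d     ∎)
  where
  open ≤-Reasoning
  d = suc d-1

archimedean′ : ∀ p → 0ℚ < q → ∃[ n ] p < ι (suc n) * q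
archimedean′ {q} p 0<q =
  let w , 0<w , qw≡1 = inverse 0<q
      n , pw<n = archimedean (p * w)
  in n , *-cancelʳ-< (<⇒≤ 0<w)
  (subst (p * w <_) (sym (trans (*-assoc (ι (suc n)) q w)
    (trans (cong (ι (suc n) *_) qw≡1) (*-identityʳ (ι (suc n)))))) pw<n)

bernoulli : ∀ {a b} → 0ℚ ≤ a → 0ℚ ≤ b → ∀ m →
            a ^ m * (a + ι (suc m) * (b - a)) ≤ b ^ suc m
bernoulli {a} {b} 0≤a 0≤b zero = ≤-reflexive
  (solve 2 (λ a b → con 1ℚ :* (a :+ (con 1ℚ :+ con 0ℚ) :* (b :- a)) := b :* con 1ℚ) refl a b)
bernoulli {a} {b} 0≤a 0≤b (suc m) = ≤-trans
  (≤-by (0≤* (0≤* (0≤ι (suc m)) (0≤^ 0≤a m)) (0≤² (b - a)))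
    (solve 4 (λ a b n A →
        b :* (A :* (a :+ n :* (b :- a)))
          := (a :* A) :* (a :+ (con 1ℚ :+ n) :* (b :- a)) :+ (n :* A) :* ((b :- a) :* (b :- a)))
      refl a b (ι (suc m)) (a ^ m)))
  (*-monoˡ 0≤b (bernoulli 0≤a 0≤b m))

record ℝ : Set₁ where
  field
    L U         : ℚ → Set
    L-inhabited : ∃[ q ] L q
    U-inhabited : ∃[ q ] U q
    L-lower     : p < q → L q → L p
    U-upper     : p < q → U p → U q
    L-open      : L p → ∃[ q ] p < q × L q
    U-open      : U q → ∃[ p ] p < q × U p
    disjoint    : L q → U q → ⊥
    located     : p < q → L p ⊎ U q

  L<U : L p → U q → p < q
  L<U {p} {q} p∈L q∈U = compare (<-cmp p q)
    where
    compare : Tri (p < q) (p ≡ q) (q < p) → p < q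
    compare (tri< p<q _ _)  = p<q
    compare (tri≈ _ refl _) = contradiction q∈U (disjoint p∈L)
    compare (tri> _ _ q<p)  = contradiction q∈U (disjoint (L-lower q<p p∈L))

open ℝ public using (L; U)

infix 4 _<ᵣ_

_<ᵣ_ : ℝ → ℝ → Set
x <ᵣ y = ∃[ q ] U x q × L y q

fromℚ : ℚ → ℝ
fromℚ p = record
  { L           = _< p
  ; U           = p <_
  ; L-inhabited = p - 1ℚ , <-by 0<1 (solve 1 (λ p → p := (p :- con 1ℚ) :+ con 1ℚ) refl p)
  ; U-inhabited = p + 1ℚ , <-by 0<1 refl
  ; L-lower     = <-trans
  ; U-upper     = λ p<q r<p → <-trans r<p p<q
  ; L-open      = <-dense
  ; U-open      = λ p<q → let r , p<r , r<q = <-dense p<q in r , r<q , p<r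
  ; disjoint    = <-asym
  ; located     = λ {q} q<r → Sum.map₂ (λ p≤q → ≤-<-trans p≤q q<r) (connex q p)
  }

-- 0 < x
Pos : ℝ → Set
Pos x = L x 0ℚ

</-ι : ∀ i m .{{_ : ℕ.NonZero m}} → p * ι m < ι i → p < + i / m
</-ι {p} i m lt = *-cancelʳ-< (0≤ι m) (subst (p * ι m <_) (sym (/-*-ι i m)) lt)

trap : (x : ℝ) → Pos x → ∀ m .{{_ : ℕ.NonZero m}} →
       ∃[ j ] L x (+ j / m) × U x (+ (2 ℕ.+ j) / m)
trap x 0<x m = go (suc J) 0 (subst (L x) (sym (0/n≡0 m)) 0<x)
                  (subst (λ i → U x (+ i / m)) (sym (ℕₚ.+-identityʳ (suc J))) J∈U)
  where
  open ℝ x hiding (L; U)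
  u = proj₁ U-inhabited
  J = proj₁ (archimedean (u * ι m))
  J∈U : U x (+ suc J / m)
  J∈U = U-upper (</-ι (suc J) m (proj₂ (archimedean (u * ι m)))) (proj₂ U-inhabited)
  go : ∀ k j → L x (+ j / m) → U x (+ (k ℕ.+ j) / m) →
       ∃[ j ] L x (+ j / m) × U x (+ (2 ℕ.+ j) / m)
  go zero    j j∈L j∈U = contradiction j∈U (disjoint j∈L)
  go (suc k) j j∈L k∈U = [
    (λ j+1∈L → go k (suc j) j+1∈L (subst (λ i → U x (+ i / m)) (sym (ℕₚ.+-suc k j)) k∈U)) ,
    (λ j+2∈U → j , j∈L , j+2∈U)
    ]′ (located {+ suc j / m} {+ (2 ℕ.+ j) / m} (</-ι (2 ℕ.+ j) m (subst (_< ι (2 ℕ.+ j)) (sym (/-*-ι (suc j) m)) (<-by 0<1 (+-comm 1ℚ (ι (suc j)))))))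

product : List ℚ → ℚ
product = foldr _*_ 1ℚ

sum : List ℚ → ℚ
sum = foldr _+_ 0ℚ

-- ln x = ∫₁ˣ dt/t as a Darboux integral.  A partition 1 = t₀, t₁, …, tₘ = x is
-- given by its ratios rᵢ = tᵢ/tᵢ₋₁, whose product is x, or by the inverse
-- ratios uᵢ = tᵢ₋₁/tᵢ, whose product is 1/x.  As 1/t is decreasing, the upper
-- and lower sums are Σ (tᵢ - tᵢ₋₁)/tᵢ₋₁ = Σ (rᵢ - 1) and
-- Σ (tᵢ - tᵢ₋₁)/tᵢ = Σ (1 - uᵢ).  Steps with tᵢ < tᵢ₋₁ (needed when x < 1)
-- are allowed: the same sums then bound the signed integral.

upperSum : List ℚ → ℚ
upperSum rs = sum (map (λ r → r - 1ℚ) rs)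

lowerSum : List ℚ → ℚ
lowerSum us = sum (map (λ u → 1ℚ - u) us)

0<product : ∀ {rs} → All (0ℚ <_) rs → 0ℚ < product rs
0<product []             = 0<1
0<product (0<r ∷ 0<rs) = 0<* 0<r (0<product 0<rs)

0≤sum : ∀ {rs} → All (0ℚ <_) rs → 0ℚ ≤ sum rs
0≤sum []           = ≤-refl
0≤sum (0<r ∷ 0<rs) = 0≤+ (<⇒≤ 0<r) (0≤sum 0<rs)

mean : ∀ {rs} → All (0ℚ <_) rs → ∃[ a ] 0ℚ ≤ a × ι (length rs) * a ≡ sum rs
mean []                            = 0ℚ , ≤-refl , refl
mean {rs@(_ ∷ ss)} 0<rs@(_ ∷ _) =
  let w , 0<w , nw≡1 = inverse (0<ι (length rs))
  in w * sum rs , 0≤* (<⇒≤ 0<w) (0≤sum 0<rs) ,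
  trans (sym (*-assoc (ι (length rs)) w (sum rs)))
    (trans (cong (_* sum rs) nw≡1) (*-identityˡ (sum rs)))

am-gm : ∀ {rs} → All (0ℚ <_) rs → ∀ {a} → 0ℚ ≤ a → ι (length rs) * a ≡ sum rs →
        product rs ≤ a ^ length rs
am-gm []                            _   _  = ≤-refl
am-gm {r ∷ rs} (0<r ∷ 0<rs) {b} 0≤b nb≡S = begin
  r * product rs                  ≤⟨ *-monoˡ (<⇒≤ 0<r) (am-gm 0<rs 0≤a na≡S) ⟩
  r * a ^ n                       ≡⟨ cong (_* a ^ n) r≡ ⟩
  (ι (suc n) * b - ι n * a) * a ^ n
    ≡⟨ solve 4 (λ n a b A → ((con 1ℚ :+ n) :* b :- n :* a) :* A
                              := A :* (a :+ (con 1ℚ :+ n) :* (b :- a)))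
         refl (ι n) a b (a ^ n) ⟩
  a ^ n * (a + ι (suc n) * (b - a)) ≤⟨ bernoulli 0≤a 0≤b n ⟩
  b ^ suc n                       ∎
  where
  open ≤-Reasoning
  n = length rs
  a = proj₁ (mean 0<rs)
  0≤a = proj₁ (proj₂ (mean 0<rs))
  na≡S = proj₂ (proj₂ (mean 0<rs))
  r≡ : r ≡ ι (suc n) * b - ι n * a
  r≡ = trans (solve 2 (λ r s → r := (r :+ s) :- s) refl r (sum rs))
             (cong₂ _-_ (sym nb≡S) (sym na≡S))

n≤sum : ∀ {rs} → All (0ℚ <_) rs → product rs ≡ 1ℚ → ι (length rs) ≤ sum rs
n≤sum [] _ = ≤-refl
n≤sum {rs@(_ ∷ _)} 0<rs@(_ ∷ _) Π≡1 = [
  (λ a<1 → contradiction (<-≤-trans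
    (subst (a ^ length rs <_) (1^ (length rs)) (^-monoˡ-< 0≤a a<1 (length rs)))
    (subst (_≤ a ^ length rs) Π≡1 (am-gm 0<rs 0≤a na≡S))) (<-irrefl refl)) ,
  (λ 1≤a → subst₂ _≤_ (*-identityʳ (ι (length rs))) na≡S (*-monoˡ (0≤ι (length rs)) 1≤a))
  ]′ (connex a 1ℚ)
  where
  a = proj₁ (mean 0<rs)
  0≤a = proj₁ (proj₂ (mean 0<rs))
  na≡S = proj₂ (proj₂ (mean 0<rs))
  1^ : ∀ n → 1ℚ ^ n ≡ 1ℚ
  1^ zero    = refl
  1^ (suc n) = trans (*-identityˡ (1ℚ ^ n)) (1^ n)

product-++ : ∀ rs ss → product (rs ++ ss) ≡ product rs * product ss
product-++ []       ss = sym (*-identityˡ (product ss))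
product-++ (r ∷ rs) ss = trans (cong (r *_) (product-++ rs ss))
  (sym (*-assoc r (product rs) (product ss)))

sum-++ : ∀ rs ss → sum (rs ++ ss) ≡ sum rs + sum ss
sum-++ []       ss = sym (+-identityˡ (sum ss))
sum-++ (r ∷ rs) ss = trans (cong (_+_ r) (sum-++ rs ss))
  (sym (+-assoc r (sum rs) (sum ss)))

upperSum≡ : ∀ rs → upperSum rs ≡ sum rs - ι (length rs)
upperSum≡ []       = refl
upperSum≡ (r ∷ rs) = trans (cong (_+_ (r - 1ℚ)) (upperSum≡ rs))
  (solve 3 (λ r s n → (r :- con 1ℚ) :+ (s :- n) := (r :+ s) :- (con 1ℚ :+ n))
    refl r (sum rs) (ι (length rs)))

lowerSum≡ : ∀ us → lowerSum us ≡ ι (length us) - sum us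
lowerSum≡ []       = refl
lowerSum≡ (u ∷ us) = trans (cong (_+_ (1ℚ - u)) (lowerSum≡ us))
  (solve 3 (λ u s n → (con 1ℚ :- u) :+ (n :- s) := (con 1ℚ :+ n) :- (u :+ s))
    refl u (sum us) (ι (length us)))

lowerSum≤upperSum : ∀ {us rs} → All (0ℚ <_) us → All (0ℚ <_) rs →
                    product us * product rs ≡ 1ℚ → lowerSum us ≤ upperSum rs
lowerSum≤upperSum {us} {rs} 0<us 0<rs Π≡1 = ≤-by
  (0≤- (n≤sum (++⁺ 0<us 0<rs) (trans (product-++ us rs) Π≡1)))
  (begin
    upperSum rs  ≡⟨ upperSum≡ rs ⟩
    sum rs - ι (length rs)
      ≡⟨ solve 4 (λ s n t m → t :- m := (n :- s) :+ ((s :+ t) :- (n :+ m))) refl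
           (sum us) (ι (length us)) (sum rs) (ι (length rs)) ⟩
    (ι (length us) - sum us) + ((sum us + sum rs) - (ι (length us) + ι (length rs)))
      ≡⟨ cong₂ _+_ (sym (lowerSum≡ us)) (cong₂ _-_ (sym (sum-++ us rs))
           (trans (sym (ι-+ (length us) (length rs))) (cong ι (sym (length-++ us))))) ⟩
    lowerSum us + (sum (us ++ rs) - ι (length (us ++ rs)))  ∎)
  where open ≡-Reasoning

-- Darboux sums of the partition with points 1 + i h, where i ≤ n.
uniform : ∀ h n → (∀ i → i ℕ.≤ n → 0ℚ < 1ℚ + ι i * h) → ∀ w → 0ℚ < w → (1ℚ + ι n * h) * w ≡ 1ℚ →
  ∃[ us ] ∃[ rs ] All (0ℚ <_) us × All (0ℚ <_) rs ×
    product us ≡ w × product rs ≡ 1ℚ + ι n * h ×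
    upperSum rs ≡ lowerSum us + h * (1ℚ - w)
uniform h zero    0<t w _ tw≡1 = [] , [] , [] , [] , sym w≡1 ,
  sym (trans (cong (_+_ 1ℚ) (*-zeroˡ h)) (+-identityʳ 1ℚ)) ,
  sym (trans (+-identityˡ _) (trans (cong (λ w → h * (1ℚ - w)) w≡1) (*-zeroʳ h)))
  where
  w≡1 : w ≡ 1ℚ
  w≡1 = trans (sym (*-identityˡ w)) (trans (cong (_* w)
    (sym (trans (cong (_+_ 1ℚ) (*-zeroˡ h)) (+-identityʳ 1ℚ)))) tw≡1)
uniform h (suc n) 0<t w′ 0<w′ t′w′≡1 =
  let w , 0<w , tw≡1 = inverse 0<t₁
      us , rs , 0<us , 0<rs , Πus≡w , Πrs≡t , eq =
        uniform h n (λ i i≤n → 0<t i (ℕₚ.m≤n⇒m≤1+n i≤n)) w 0<w tw≡1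
  in
  t * w′ ∷ us , t′ * w ∷ rs ,
  0<* 0<t₁ 0<w′ ∷ 0<us , 0<* 0<t′ 0<w ∷ 0<rs ,
  trans (cong (t * w′ *_) Πus≡w) (trans (rearr t w′ w) (trans (cong (_* w′) tw≡1) (*-identityˡ w′))) ,
  trans (cong (t′ * w *_) Πrs≡t) (trans (trans (*-assoc t′ w t) (cong (t′ *_) (trans (*-comm w t) tw≡1))) (*-identityʳ t′)) ,
  (begin
    (t′ * w - 1ℚ) + upperSum rs
      ≡⟨ cong₂ _+_ (trans (cong (λ z → t′ * w - z) (sym tw≡1)) (diff w)) eq ⟩
    h * w + (lowerSum us + h * (1ℚ - w))
      ≡⟨ solve 4 (λ h w w′ l → h :* w :+ (l :+ h :* (con 1ℚ :- w))
             := (h :* w′ :+ l) :+ h :* (con 1ℚ :- w′)) refl h w w′ (lowerSum us) ⟩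
    (h * w′ + lowerSum us) + h * (1ℚ - w′)
      ≡⟨ cong (λ z → z + lowerSum us + h * (1ℚ - w′))
             (trans (sym (diff w′)) (cong (_- t * w′) t′w′≡1)) ⟩
    (1ℚ - t * w′ + lowerSum us) + h * (1ℚ - w′) ∎)
  where
  open ≡-Reasoning
  t = 1ℚ + ι n * h
  t′ = 1ℚ + ι (suc n) * h
  0<t′ = 0<t (suc n) ℕₚ.≤-refl
  0<t₁ = 0<t n (ℕₚ.n≤1+n n)
  diff : ∀ w → t′ * w - t * w ≡ h * w
  diff = solve 3 (λ h n w → (con 1ℚ :+ (con 1ℚ :+ n) :* h) :* w :- (con 1ℚ :+ n :* h) :* w
                              := h :* w) refl h (ι n)
  rearr : ∀ t w′ w → t * w′ * w ≡ t * w * w′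
  rearr = solve 3 (λ t w′ w → t :* w′ :* w := t :* w :* w′) refl

LowerLn : ℚ → ℚ → Set
LowerLn x q = ∃[ us ] All (0ℚ <_) us × product us * x ≡ 1ℚ × q < lowerSum us

UpperLn : ℚ → ℚ → Set
UpperLn x q = ∃[ rs ] All (0ℚ <_) rs × product rs ≡ x × upperSum rs < q

ln-located : ∀ x w → 0ℚ < x → 0ℚ < w → x * w ≡ 1ℚ → p < q →
  ∀ n δ → 0ℚ < δ → ι n * δ ≡ 1ℚ → (x - 1ℚ) * (1ℚ - w) < ι n * (q - p) →
  LowerLn x p ⊎ UpperLn x q
ln-located {p} {q} x w 0<x 0<w xw≡1 p<q n δ 0<δ nδ≡1 K<n[q-p] =
  choose (uniform h n 0<t w 0<w (trans (cong (_* w) t≡x) xw≡1))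
  where
  h = δ * (x - 1ℚ)

  t≡x : 1ℚ + ι n * h ≡ x
  t≡x = trans (cong (_+_ 1ℚ) (trans (sym (*-assoc (ι n) δ (x - 1ℚ)))
    (trans (cong (_* (x - 1ℚ)) nδ≡1) (*-identityˡ (x - 1ℚ)))))
    (solve 1 (λ x → con 1ℚ :+ (x :- con 1ℚ) := x) refl x)

  0<t : ∀ i → i ℕ.≤ n → 0ℚ < 1ℚ + ι i * h
  0<t zero      _   = subst (0ℚ <_) (sym (cong (_+_ 1ℚ) (*-zeroˡ h))) 0<1
  0<t i@(suc _) i≤n = let j , i+j≡n = ℕₚ.m≤n⇒∃[o]m+o≡n i≤n in subst (0ℚ <_) (begin
    (ι i * x + ι j) * δ
      ≡⟨ solve 4 (λ i j x δ → (i :* x :+ j) :* δ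
                    := (i :+ j) :* δ :+ i :* (δ :* (x :- con 1ℚ))) refl (ι i) (ι j) x δ ⟩
    (ι i + ι j) * δ + ι i * h
      ≡⟨ cong (λ z → z * δ + ι i * h) (trans (sym (ι-+ i j)) (cong ι i+j≡n)) ⟩
    ι n * δ + ι i * h
      ≡⟨ cong (_+ ι i * h) nδ≡1 ⟩
    1ℚ + ι i * h  ∎)
    (0<* (+-mono-<-≤ {0ℚ} (0<* (0<ι i) 0<x) (0≤ι j)) 0<δ)
    where open ≡-Reasoning

  upper : ∀ S T → T ≡ S + h * (1ℚ - w) → S ≤ p → T < q
  upper S T eq S≤p = begin-strict
    T                  ≡⟨ eq ⟩
    S + h * (1ℚ - w)   ≤⟨ +-monoˡ-≤ (h * (1ℚ - w)) S≤p ⟩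
    p + h * (1ℚ - w)
      ≡⟨ solve 4 (λ p δ x w → p :+ (δ :* (x :- con 1ℚ)) :* (con 1ℚ :- w)
                    := p :+ ((x :- con 1ℚ) :* (con 1ℚ :- w)) :* δ) refl p δ x w ⟩
    p + ((x - 1ℚ) * (1ℚ - w)) * δ  <⟨ +-monoʳ-< p (*-monoʳ-< 0<δ K<n[q-p]) ⟩
    p + (ι n * (q - p)) * δ
      ≡⟨ solve 4 (λ p q n δ → p :+ (n :* (q :- p)) :* δ := p :+ (n :* δ) :* (q :- p))
           refl p q (ι n) δ ⟩
    p + (ι n * δ) * (q - p)  ≡⟨ cong (λ z → p + z * (q - p)) nδ≡1 ⟩
    p + 1ℚ * (q - p)
      ≡⟨ solve 2 (λ p q → p :+ con 1ℚ :* (q :- p) := q) refl p q ⟩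
    q                        ∎
    where open ≤-Reasoning

  choose : ∃[ us ] ∃[ rs ] All (0ℚ <_) us × All (0ℚ <_) rs ×
             product us ≡ w × product rs ≡ 1ℚ + ι n * h ×
             upperSum rs ≡ lowerSum us + h * (1ℚ - w) →
           LowerLn x p ⊎ UpperLn x q
  choose (us , rs , 0<us , 0<rs , Πus≡w , Πrs≡t , eq) = Sum.map
    (λ p<S → us , 0<us , trans (cong (_* x) Πus≡w) (trans (*-comm w x) xw≡1) , p<S)
    (λ S≤p → rs , 0<rs , trans Πrs≡t t≡x , upper (lowerSum us) (upperSum rs) eq S≤p)
    (connex p (lowerSum us))

ln : (x : ℚ) .{{_ : Positive x}} → ℝ
ln x = record
  { L           = LowerLn x
  ; U           = UpperLn x
  ; L-inhabited = L-inh (inverse 0<x)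
  ; U-inhabited = let u , x-1<u = ℝ.U-inhabited (fromℚ (upperSum (x ∷ [])))
                  in u , x ∷ [] , 0<x ∷ [] , *-identityʳ x , x-1<u
  ; L-lower     = λ { p<q (us , 0<us , Π , q<S) → us , 0<us , Π , <-trans p<q q<S }
  ; U-upper     = λ { p<q (rs , 0<rs , Π , S<p) → rs , 0<rs , Π , <-trans S<p p<q }
  ; L-open      = λ { (us , 0<us , Π , p<S) → let q , p<q , q<S = <-dense p<S
                                               in q , p<q , us , 0<us , Π , q<S }
  ; U-open      = λ { (rs , 0<rs , Π , S<q) → let p , S<p , p<q = <-dense S<q
                                               in p , p<q , rs , 0<rs , Π , S<p }
  ; disjoint    = λ { (us , 0<us , Π , q<S) (rs , 0<rs , Πrs , T<q) →
                      <-irrefl refl (<-trans T<q (<-≤-trans q<S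
                        (lowerSum≤upperSum 0<us 0<rs (trans (cong (product us *_) Πrs) Π)))) }
  ; located     = loc (inverse 0<x)
  }
  where
  0<x = positive⁻¹ x
  L-inh : ∃[ w ] 0ℚ < w × x * w ≡ 1ℚ → ∃[ q ] LowerLn x q
  L-inh (w , 0<w , xw≡1) =
    let l , l<1-w = ℝ.L-inhabited (fromℚ (lowerSum (w ∷ [])))
    in l , w ∷ [] , 0<w ∷ [] ,
       trans (cong (_* x) (*-identityʳ w)) (trans (*-comm w x) xw≡1) , l<1-w
  loc : ∃[ w ] 0ℚ < w × x * w ≡ 1ℚ → ∀ {p q} → p < q → LowerLn x p ⊎ UpperLn x q
  loc (w , 0<w , xw≡1) {p} {q} p<q = step (archimedean′ ((x - 1ℚ) * (1ℚ - w)) (0<- p<q))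
    where
    step : ∃[ n ] (x - 1ℚ) * (1ℚ - w) < ι (suc n) * (q - p) → LowerLn x p ⊎ UpperLn x q
    step (n , K<) = let δ , 0<δ , nδ≡1 = inverse (0<ι (suc n))
                    in ln-located x w 0<x 0<w xw≡1 p<q (suc n) δ 0<δ nδ≡1 K<

ln-pos : (x : ℚ) .{{_ : Positive x}} → 1ℚ < x → Pos (ln x)
ln-pos x 1<x = proof (inverse (positive⁻¹ x))
  where
  sum-pos : ∀ w → w < 1ℚ → 0ℚ < lowerSum (w ∷ [])
  sum-pos w w<1 = subst (0ℚ <_) (sym (+-identityʳ (1ℚ - w))) (0<- w<1)
  proof : ∃[ w ] 0ℚ < w × x * w ≡ 1ℚ → Pos (ln x)
  proof (w , 0<w , xw≡1) = w ∷ [] , 0<w ∷ [] ,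
    trans (cong (_* x) (*-identityʳ w)) (trans (*-comm w x) xw≡1) ,
    sum-pos w (subst₂ _<_ (*-identityˡ w) xw≡1 (*-monoʳ-< 0<w 1<x))

grid-bound : ∀ i j m .{{_ : ℕ.NonZero m}} b₀ → 0ℚ < p → p < q →
  ι 2 * q + ι 2 < ι m * ((q - p) * b₀) → b₀ < + (2 ℕ.+ j) / m →
  ι i ≤ p * ι (2 ℕ.+ j) → 0ℚ < + j / m × + (2 ℕ.+ i) / m < q * (+ j / m)
grid-bound {p} {q} i j m b₀ 0<p p<q K<m[q-p]b₀ b₀<j+2 i≤pj+2 =
  0<j/m , *-cancelʳ-< (0≤ι m)
    (subst₂ _<_ (sym (/-*-ι (2 ℕ.+ i) m))
      (sym (trans (*-assoc q (+ j / m) (ι m)) (cong (q *_) (/-*-ι j m)))) i+2<qj)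
  where
  open ≤-Reasoning
  b₀m<j+2 : b₀ * ι m < ι (2 ℕ.+ j)
  b₀m<j+2 = subst (b₀ * ι m <_) (/-*-ι (2 ℕ.+ j) m) (*-monoʳ-< (0<ι m) b₀<j+2)
  2p+2<[q-p]j : ι 2 * p + ι 2 < ι j * (q - p)
  2p+2<[q-p]j = begin-strict
    ι 2 * p + ι 2
      ≡⟨ solve 2 (λ p q → con (ι 2) :* p :+ con (ι 2)
                            := (con (ι 2) :* q :+ con (ι 2)) :- con (ι 2) :* (q :- p)) refl p q ⟩
    (ι 2 * q + ι 2) - ι 2 * (q - p)
      <⟨ +-monoˡ-< (- (ι 2 * (q - p))) K<m[q-p]b₀ ⟩
    ι m * ((q - p) * b₀) - ι 2 * (q - p)
      ≡⟨ solve 3 (λ m d b → m :* (d :* b) :- con (ι 2) :* d := (b :* m) :* d :- con (ι 2) :* d)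
           refl (ι m) (q - p) b₀ ⟩
    (b₀ * ι m) * (q - p) - ι 2 * (q - p)
      <⟨ +-monoˡ-< (- (ι 2 * (q - p))) (*-monoʳ-< (0<- p<q) b₀m<j+2) ⟩
    ι (2 ℕ.+ j) * (q - p) - ι 2 * (q - p)
      ≡⟨ solve 2 (λ j d → (con 1ℚ :+ (con 1ℚ :+ j)) :* d :- con (ι 2) :* d := j :* d)
           refl (ι j) (q - p) ⟩
    ι j * (q - p) ∎
  0<j : 0ℚ < ι j
  0<j = *-cancelʳ-< {q - p} {0ℚ} {ι j} (<⇒≤ (0<- p<q)) (begin-strict
    0ℚ * (q - p)   ≡⟨ *-zeroˡ (q - p) ⟩
    0ℚ             <⟨ +-mono-< {0ℚ} (0<* (0<ι 2) 0<p) (0<ι 2) ⟩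
    ι 2 * p + ι 2    <⟨ 2p+2<[q-p]j ⟩
    ι j * (q - p)  ∎)
  0<j/m : 0ℚ < + j / m
  0<j/m = </-ι j m (subst (_< ι j) (sym (*-zeroˡ (ι m))) 0<j)
  i+2<qj : ι (2 ℕ.+ i) < q * ι j
  i+2<qj = begin-strict
    ι (2 ℕ.+ i)                      ≡⟨ solve 1 (λ i → con 1ℚ :+ (con 1ℚ :+ i) := i :+ con (ι 2)) refl (ι i) ⟩
    ι i + ι 2                         ≤⟨ +-monoˡ-≤ (ι 2) i≤pj+2 ⟩
    p * ι (2 ℕ.+ j) + ι 2
      ≡⟨ solve 2 (λ p j → p :* (con 1ℚ :+ (con 1ℚ :+ j)) :+ con (ι 2)
                            := p :* j :+ (con (ι 2) :* p :+ con (ι 2))) refl p (ι j) ⟩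
    p * ι j + (ι 2 * p + ι 2)          <⟨ +-monoʳ-< (p * ι j) 2p+2<[q-p]j ⟩
    p * ι j + ι j * (q - p)
      ≡⟨ solve 3 (λ p q j → p :* j :+ j :* (q :- p) := q :* j) refl p q (ι j) ⟩
    q * ι j                          ∎

divide : 0ℚ < q → p < r → ∃[ s ] p < s * q × s * q < r
divide {q} {p} {r} 0<q p<r = go (<-dense p<r) (inverse 0<q)
  where
  go : ∃[ d ] p < d × d < r → ∃[ w ] 0ℚ < w × q * w ≡ 1ℚ → ∃[ s ] p < s * q × s * q < r
  go (d , p<d , d<r) (w , _ , qw≡1) = d * w , subst (p <_) (sym d≡) p<d , subst (_< r) (sym d≡) d<r
    where
    d≡ : d * w * q ≡ d
    d≡ = trans (*-assoc d w q) (trans (cong (d *_) (trans (*-comm w q) qw≡1)) (*-identityʳ d))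

-- For x, y > 0: r < x / y iff r b < a for some a < x and b > y, and r > x / y
-- iff r b > a for some a > x and 0 < b < y.
quotient : (x y : ℝ) → Pos x → Pos y → ℝ
quotient x y 0<x 0<y = record
  { L           = LQ
  ; U           = UQ
  ; L-inhabited = 0ℚ , 0∈L (X.L-open 0<x) Y.U-inhabited
  ; U-inhabited = U-inh X.U-inhabited (Y.L-open 0<y)
  ; L-lower     = λ { p<q (a , b , a∈L , b∈U , qb<a) →
                      a , b , a∈L , b∈U , <-trans (*-monoʳ-< (Y.L<U 0<y b∈U) p<q) qb<a }
  ; U-upper     = λ { p<q (a , b , a∈U , b∈L , 0<b , a<pb) →
                      a , b , a∈U , b∈L , 0<b , <-trans a<pb (*-monoʳ-< 0<b p<q) }
  ; L-open      = λ { (a , b , a∈L , b∈U , pb<a) →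
                      let q , pb<qb , qb<a = divide (Y.L<U 0<y b∈U) pb<a
                      in q , *-cancelʳ-< (<⇒≤ (Y.L<U 0<y b∈U)) pb<qb , a , b , a∈L , b∈U , qb<a }
  ; U-open      = λ { (a , b , a∈U , b∈L , 0<b , a<qb) →
                      let p , a<pb , pb<qb = divide 0<b a<qb
                      in p , *-cancelʳ-< (<⇒≤ 0<b) pb<qb , a , b , a∈U , b∈L , 0<b , a<pb }
  ; disjoint    = λ {r} → disj {r}
  ; located     = loc
  }
  where
  module X = ℝ x
  module Y = ℝ y

  LQ UQ : ℚ → Set
  LQ r = ∃[ a ] ∃[ b ] L x a × U y b × r * b < a
  UQ r = ∃[ a ] ∃[ b ] U x a × L y b × 0ℚ < b × a < r * b

  0∈L : ∃[ a ] 0ℚ < a × L x a → ∃[ b ] U y b → LQ 0ℚ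
  0∈L (a , 0<a , a∈L) (b , b∈U) = a , b , a∈L , b∈U , subst (_< a) (sym (*-zeroˡ b)) 0<a

  U-inh : ∃[ a ] U x a → ∃[ b ] 0ℚ < b × L y b → ∃[ r ] UQ r
  U-inh (a , a∈U) (b , 0<b , b∈L) =
    let r , a<rb , _ = divide 0<b (<-by {1ℚ} {a + 1ℚ} {a} 0<1 refl)
    in r , a , b , a∈U , b∈L , 0<b , a<rb

  disj : LQ r → UQ r → ⊥
  disj {r} (a , b , a∈L , b∈U , rb<a) (a′ , b′ , a′∈U , b′∈L , 0<b′ , a′<rb′) =
    <-irrefl refl (<-trans rb<a (<-trans (X.L<U a∈L a′∈U) (<-trans a′<rb′ rb′<rb)))
    where
    0<r : 0ℚ < r
    0<r = *-cancelʳ-< (<⇒≤ 0<b′)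
      (subst (_< r * b′) (sym (*-zeroˡ b′)) (<-trans (X.L<U 0<x a′∈U) a′<rb′))
    rb′<rb : r * b′ < r * b
    rb′<rb = subst₂ _<_ (*-comm b′ r) (*-comm b r) (*-monoʳ-< 0<r (Y.L<U b′∈L b∈U))

  loc : p < q → LQ p ⊎ UQ q
  loc {p} {q} p<q = [ (λ 0<p → loc⁺ 0<p (Y.L-open 0<y)) , inj₁ ∘ loc⁻ (X.L-open 0<x) Y.U-inhabited ]′
                      (connex 0ℚ p)
    where
    loc⁻ : ∃[ a ] 0ℚ < a × L x a → ∃[ b ] U y b → p ≤ 0ℚ → LQ p
    loc⁻ (a , 0<a , a∈L) (b , b∈U) p≤0 = a , b , a∈L , b∈U ,
      ≤-<-trans (subst (p * b ≤_) (*-zeroˡ b) (*-monoʳ (<⇒≤ (Y.L<U 0<y b∈U)) p≤0)) 0<a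

    loc⁺ : 0ℚ < p → ∃[ b ] 0ℚ < b × L y b → LQ p ⊎ UQ q
    loc⁺ 0<p (b₀ , 0<b₀ , b₀∈L) = refine (archimedean′ (ι 2 * q + ι 2) (0<* (0<- p<q) 0<b₀))
      where
      choose : ∀ m .{{_ : ℕ.NonZero m}} → ι 2 * q + ι 2 < ι m * ((q - p) * b₀) →
               ∃[ i ] L x (+ i / m) × U x (+ (2 ℕ.+ i) / m) →
               ∃[ j ] L y (+ j / m) × U y (+ (2 ℕ.+ j) / m) → LQ p ⊎ UQ q
      choose m K< (i , i∈L , i+2∈U) (j , j∈L , j+2∈U) = Sum.map
        (λ lt → + i / m , + (2 ℕ.+ j) / m , i∈L , j+2∈U , *-cancelʳ-< (0≤ι m)
          (subst₂ _<_
            (sym (trans (*-assoc p (+ (2 ℕ.+ j) / m) (ι m)) (cong (p *_) (/-*-ι (2 ℕ.+ j) m))))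
            (sym (/-*-ι i m)) lt))
        (λ i≤ → + (2 ℕ.+ i) / m , + j / m , i+2∈U , j∈L ,
          grid-bound i j m b₀ 0<p p<q K< (Y.L<U b₀∈L j+2∈U) i≤)
        (connex (p * ι (2 ℕ.+ j)) (ι i))

      refine : ∃[ n ] ι 2 * q + ι 2 < ι (suc n) * ((q - p) * b₀) → LQ p ⊎ UQ q
      refine (n , K<) = choose (suc n) K< (trap x 0<x (suc n)) (trap y 0<y (suc n))

quotient-pos : ∀ x y 0<x 0<y → Pos (quotient x y 0<x 0<y)
quotient-pos x y 0<x 0<y = proj₂ (ℝ.L-inhabited (quotient x y 0<x 0<y))

-- bʸ for b ≥ 1 and y > 0, as the supremum of the rational powers b^(i/m) with
-- i/m < y and the infimum of those with i/m > y.  For v ≥ 0, v ≤ b^(i/m) means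
-- vᵐ ≤ bⁱ.
power : (b : ℚ) → 1ℚ ≤ b → (y : ℝ) → Pos y → ℝ
power b 1≤b y 0<y = record
  { L           = LP
  ; U           = UP
  ; L-inhabited = - 1ℚ , neg∈L (negative⁻¹ (- 1ℚ))
  ; U-inhabited = U-inh Y.U-inhabited
  ; L-lower     = λ { p<q (v , q<v , ub) → v , <-trans p<q q<v , ub }
  ; U-upper     = λ { p<q (v , v<p , lb) → v , <-trans v<p p<q , lb }
  ; L-open      = λ { (v , p<v , ub) → let q , p<q , q<v = <-dense p<v in q , p<q , v , q<v , ub }
  ; U-open      = λ { (v , v<q , lb) → let p , v<p , p<q = <-dense v<q in p , p<q , v , v<p , lb }
  ; disjoint    = λ {r} → disj {r}
  ; located     = loc
  }
  where
  module Y = ℝ y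

  LP UP : ℚ → Set
  LP r = ∃[ v ] r < v × 0ℚ ≤ v × ∃[ i ] Σ[ m ∈ ℕ ] Σ[ m≢0 ∈ ℕ.NonZero m ]
           L y ((+ i / m) {{m≢0}}) × v ^ m ≤ b ^ i
  UP r = ∃[ v ] v < r × 0ℚ ≤ v × ∃[ i ] Σ[ m ∈ ℕ ] Σ[ m≢0 ∈ ℕ.NonZero m ]
           U y ((+ i / m) {{m≢0}}) × b ^ i ≤ v ^ m

  0≤b : 0ℚ ≤ b
  0≤b = ≤-trans 0≤1 1≤b

  neg∈L : r < 0ℚ → LP r
  neg∈L r<0 = 0ℚ , r<0 , ≤-refl , 0 , 1 , _ , 0<y , 0≤1

  U-inh : ∃[ u ] U y u → ∃[ r ] UP r
  U-inh (u , u∈U) = bound (archimedean (u * ι 1))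
    where
    bound : ∃[ j ] u * ι 1 < ι (suc j) → ∃[ r ] UP r
    bound (j , u<j) = b ^ suc j + 1ℚ , b ^ suc j , <-by 0<1 refl , 0≤^ 0≤b (suc j) ,
      suc j , 1 , _ , Y.U-upper (</-ι (suc j) 1 u<j) u∈U ,
      ≤-reflexive (sym (*-identityʳ (b ^ suc j)))

  disj : LP r → UP r → ⊥
  disj (v , r<v , 0≤v , i , m , m≢0 , i/m∈L , vᵐ≤bⁱ) (w , w<r , 0≤w , j , l , l≢0 , j/l∈U , bʲ≤wˡ) =
    <-irrefl refl (begin-strict
      v ^ (m ℕ.* l)    ≡⟨ ^-assocʳ v m l ⟨
      (v ^ m) ^ l      ≤⟨ ^-monoˡ (0≤^ 0≤v m) vᵐ≤bⁱ l ⟩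
      (b ^ i) ^ l      ≡⟨ ^-assocʳ b i l ⟩
      b ^ (i ℕ.* l)    ≤⟨ ^-monoʳ 1≤b (ℕₚ.<⇒≤ il<jm) ⟩
      b ^ (j ℕ.* m)    ≡⟨ ^-assocʳ b j m ⟨
      (b ^ j) ^ m      ≤⟨ ^-monoˡ (0≤^ 0≤b j) bʲ≤wˡ m ⟩
      (w ^ l) ^ m      ≡⟨ ^-assocʳ w l m ⟩
      w ^ (l ℕ.* m)    ≡⟨ cong (w ^_) (ℕₚ.*-comm l m) ⟩
      w ^ (m ℕ.* l)    <⟨ ^-monoˡ-< 0≤w (<-trans w<r r<v) (m ℕ.* l) ⟩
      v ^ (m ℕ.* l)    ∎)
    where
    open ≤-Reasoning
    instance
      _ = m≢0
      _ = l≢0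
      _ = ℕₚ.m*n≢0 m l
    il<jm : i ℕ.* l ℕ.< j ℕ.* m
    il<jm = ι-cancel-< (begin-strict
      ι (i ℕ.* l)            ≡⟨ ι-* i l ⟩
      ι i * ι l              ≡⟨ cong (_* ι l) (/-*-ι i m) ⟨
      + i / m * ι m * ι l    <⟨ *-monoʳ-< (0<ι l) (*-monoʳ-< (0<ι m) (Y.L<U i/m∈L j/l∈U)) ⟩
      + j / l * ι m * ι l
        ≡⟨ solve 3 (λ q m l → q :* m :* l := q :* l :* m) refl (+ j / l) (ι m) (ι l) ⟩
      + j / l * ι l * ι m    ≡⟨ cong (_* ι m) (/-*-ι j l) ⟩
      ι j * ι m              ≡⟨ ι-* j m ⟨
      ι (j ℕ.* m)            ∎)

  loc : p < q → LP p ⊎ UP q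
  loc {p} {q} p<q = [ inj₁ ∘ neg∈L , between (<-dense p<q) ]′ (connex p 0ℚ)
    where
    between : ∃[ v ] p < v × v < q → 0ℚ ≤ p → LP p ⊎ UP q
    between (v , p<v , v<q) 0≤p = between′ (<-dense v<q)
      where
      0≤v = ≤-trans 0≤p (<⇒≤ p<v)

      choose : ∀ w → v < w → w < q → ∀ k → b * (b * v) < ι (suc k) * (w - v) →
        ∃[ j ] L y (+ j / suc k) × U y (+ (2 ℕ.+ j) / suc k) → LP p ⊎ UP q
      choose w v<w w<q k b²v< (j , j∈L , j+2∈U) = [
        (λ bʲ<vᵐ → inj₂ (w , w<q , 0≤w , 2 ℕ.+ j , suc k , _ , j+2∈U , above (<⇒≤ bʲ<vᵐ))) ,
        (λ vᵐ≤bʲ → inj₁ (v , p<v , 0≤v , j , suc k , _ , j∈L , vᵐ≤bʲ))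
        ]′ (connex (b ^ j) (v ^ suc k))
        where
        open ≤-Reasoning
        0≤w = ≤-trans 0≤v (<⇒≤ v<w)
        above : b ^ j ≤ v ^ suc k → b ^ (2 ℕ.+ j) ≤ w ^ suc k
        above bʲ≤vᵐ = begin
          b * (b * b ^ j)        ≤⟨ *-monoˡ 0≤b (*-monoˡ 0≤b bʲ≤vᵐ) ⟩
          b * (b * (v * v ^ k))
            ≡⟨ solve 3 (λ b v V → b :* (b :* (v :* V)) := V :* (b :* (b :* v)))
                 refl b v (v ^ k) ⟩
          v ^ k * (b * (b * v))
            ≤⟨ *-monoˡ (0≤^ 0≤v k) (≤-trans (<⇒≤ b²v<)
                 (≤-by 0≤v (+-comm v (ι (suc k) * (w - v))))) ⟩
          v ^ k * (v + ι (suc k) * (w - v))  ≤⟨ bernoulli 0≤v 0≤w k ⟩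
          w ^ suc k              ∎

      between′ : ∃[ w ] v < w × w < q → LP p ⊎ UP q
      between′ (w , v<w , w<q) = refine (archimedean′ (b * (b * v)) (0<- v<w))
        where
        refine : ∃[ k ] b * (b * v) < ι (suc k) * (w - v) → LP p ⊎ UP q
        refine (k , b²v<) = choose w v<w w<q k b²v< (trap y 0<y (suc k))

1≤8/5 : 1ℚ ≤ + 8 / 5
1≤8/5 = from-yes (1ℚ ≤? + 8 / 5)

0<ln[4/3] : Pos (ln (+ 4 / 3))
0<ln[4/3] = ln-pos (+ 4 / 3) (from-yes (1ℚ <? + 4 / 3))

0<ln[13/9] : Pos (ln (+ 13 / 9))
0<ln[13/9] = ln-pos (+ 13 / 9) (from-yes (1ℚ <? + 13 / 9))

0<ln[4/3]/ln[13/9] : Pos (quotient (ln (+ 4 / 3)) (ln (+ 13 / 9)) 0<ln[4/3] 0<ln[13/9])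
0<ln[4/3]/ln[13/9] = quotient-pos (ln (+ 4 / 3)) (ln (+ 13 / 9)) 0<ln[4/3] 0<ln[13/9]

{-# OPTIONS --safe #-}
module Submission where

-- Let c = ln (4/3) / ln (13/9), so that I(3) = I(9)ᶜ.  For every odd prime p and a ≥ 1,
-- I(p²ᵃ)ᶜ ≤ I(pᵃ): apart from the equality case pᵃ = 3 there is room to spare, and already
-- I(p²ᵃ)⁴ ≤ I(pᵃ)⁵ holds, which suffices because c < 4/5.  By multiplicativity I(n²)ᶜ ≤ I(n)
-- for odd n.  Finally I(qᵏ) I(n²) = 2 and I(qᵏ) < q/(q - 1) ≤ 5/4 give I(n²) > 8/5.
-- The real exponent is only ever approached through rationals i/m < c < (i + 2)/m: for m large
-- enough, (8/5)ⁱ⁺² < I(n²)ⁱ ≤ I(n)ᵐ.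

open import Algebra.Bundles using (CommutativeRing)
open import Data.Integer.Base using (+_)
open import Data.List.Base using (List; []; _∷_; _++_; applyUpTo; concat; map; replicate)
open import Data.List.Membership.Propositional using (_∈_)
open import Data.List.Membership.Propositional.Properties
open import Data.List.Membership.Propositional.Properties.WithK using (unique∧set⇒bag)
open import Data.List.Properties using (map-++)
open import Data.List.Relation.Binary.BagAndSetEquality using (∼bag⇒↭)
open import Data.List.Relation.Unary.All using (All; []; _∷_)
open import Data.List.Relation.Unary.All.Properties using (++⁺)
open import Data.List.Relation.Unary.Unique.Propositional using (Unique)
import Data.List.Relation.Unary.Unique.Propositional.Properties as Unique
open import Data.Nat.Base as ℕ using (ℕ; zero; suc; NonZero; NonTrivial)
open import Data.Nat.Coprimality using (Coprime; coprime-divisor; gcd≡1⇒coprime)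
open import Data.Nat.Divisibility hiding (quotient)
open import Data.Nat.DivMod using (_%_)
open import Data.Nat.Induction using (<-rec)
import Data.Nat.ListAction as ℕ
import Data.Nat.ListAction.Properties as ℕₗ
open import Data.Nat.Primality
open import Data.Nat.Primality.Factorisation using (factorise; PrimeFactorisation)
import Data.Nat.Properties as ℕₚ
open import Data.Nat.Tactic.RingSolver using (solve-∀)
open import Data.Product.Base using (∃-syntax; _×_; _,_; proj₂)
open import Data.Rational.Base hiding (NonZero)
open import Data.Rational.Properties
open import Data.Rational.Solver using (module +-*-Solver)
open import Data.Sum.Base using (inj₁; inj₂; [_,_]′)
open import Function.Base using (_∘_; id)
open import Function.Bundles using (mk⇔)
open import Relation.Binary.PropositionalEquality
open import Relation.Nullary using (¬_; yes; no; contradiction)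
open import Relation.Nullary.Decidable using (from-yes; from-no)
open import Defs

open CommutativeRing +-*-commutativeRing using (commutativeSemiring)
open import Algebra.Properties.CommutativeSemiring.Exp commutativeSemiring
  using (_^_; ^-assocʳ; ^-distrib-*)
open +-*-Solver using (solve; _:=_; _:+_; _:*_; _:-_; con)

private
  variable
    p q w x y : ℚ

-- Divisor lists and the recursion for σ at a prime.

∈-divisors⁺ : ∀ {d n} .{{_ : NonZero n}} → d ∣ n → d ∈ divisors n
∈-divisors⁺ {zero}  {n} 0∣n = contradiction (0∣⇒≡0 0∣n) (ℕ.≢-nonZero⁻¹ n)
∈-divisors⁺ {suc d} {n} d∣n = ∈-filter⁺ (_∣? n) (∈-applyUpTo⁺ suc (∣⇒≤ d∣n)) d∣n

∈-divisors⁻ : ∀ {d n} → d ∈ divisors n → d ∣ n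
∈-divisors⁻ {n = n} d∈ = proj₂ (∈-filter⁻ (_∣? n) {xs = applyUpTo suc n} d∈)

divisors-unique : ∀ n → Unique (divisors n)
divisors-unique n = Unique.filter⁺ (_∣? n)
  (Unique.applyUpTo⁺₁ suc n λ i<j _ → ℕₚ.<⇒≢ i<j ∘ ℕₚ.suc-injective)

sum-map-* : ∀ p ds → ℕ.sum (map (p ℕ.*_) ds) ≡ p ℕ.* ℕ.sum ds
sum-map-* p []       = sym (ℕₚ.*-zeroʳ p)
sum-map-* p (d ∷ ds) = trans (cong (p ℕ.* d ℕ.+_) (sum-map-* p ds))
  (sym (ℕₚ.*-distribˡ-+ p d (ℕ.sum ds)))

coprime-^-divisor : ∀ {d p} → Coprime d p → ∀ a {r} → d ∣ p ℕ.^ a ℕ.* r → d ∣ r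
coprime-^-divisor {d} c zero {r} = subst (d ∣_) (ℕₚ.*-identityˡ r)
coprime-^-divisor {d} {p} c (suc a) {r} d∣ =
  coprime-^-divisor c a (coprime-divisor c (subst (d ∣_) (ℕₚ.*-assoc p (p ℕ.^ a) r) d∣))

prime∤⇒coprime : ∀ {d p} → Prime p → ¬ p ∣ d → Coprime d p
prime∤⇒coprime pp p∤d (e∣d , e∣p) =
  [ id , (λ { refl → contradiction e∣d p∤d }) ]′ (prime⇒irreducible pp e∣p)

-- A divisor of pᵃ⁺¹r is p times a divisor of pᵃr, or else prime to p and hence a divisor of r.
σ-prime-* : ∀ {p} → Prime p → ∀ a {r} .{{_ : NonZero r}} → ¬ p ∣ r →
            σ (p ℕ.^ suc a ℕ.* r) ≡ p ℕ.* σ (p ℕ.^ a ℕ.* r) ℕ.+ σ r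
σ-prime-* {p} pp a {r} p∤r = begin
  σ (p ℕ.^ suc a ℕ.* r)                            ≡⟨ ℕₗ.sum-↭ (∼bag⇒↭ same-elements) ⟩
  ℕ.sum (map (p ℕ.*_) (divisors s) ++ divisors r)  ≡⟨ ℕₗ.sum-++ (map (p ℕ.*_) (divisors s)) (divisors r) ⟩
  ℕ.sum (map (p ℕ.*_) (divisors s)) ℕ.+ σ r        ≡⟨ cong (ℕ._+ σ r) (sum-map-* p (divisors s)) ⟩
  p ℕ.* σ s ℕ.+ σ r                                ∎
  where
  open ≡-Reasoning
  s = p ℕ.^ a ℕ.* r
  ps≡ : p ℕ.^ suc a ℕ.* r ≡ p ℕ.* s
  ps≡ = ℕₚ.*-assoc p (p ℕ.^ a) r
  instance
    p≢0 = prime⇒nonZero pp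
    pᵃ≢0 = ℕₚ.m^n≢0 p a
    pᵃ⁺¹≢0 = ℕₚ.m^n≢0 p (suc a)
    s≢0 = ℕₚ.m*n≢0 (p ℕ.^ a) r
    ps≢0 = ℕₚ.m*n≢0 (p ℕ.^ suc a) r

  unique : Unique (map (p ℕ.*_) (divisors s) ++ divisors r)
  unique = Unique.++⁺
    (Unique.map⁺ (λ {x} {y} → ℕₚ.*-cancelˡ-≡ x y p) (divisors-unique s)) (divisors-unique r)
    λ { (∈map , ∈r) → let e , _ , d≡pe = ∈-map⁻ (p ℕ.*_) ∈map in
        p∤r (∣-trans (divides e (trans d≡pe (ℕₚ.*-comm p e))) (∈-divisors⁻ ∈r)) }

  to : ∀ {d} → d ∈ divisors (p ℕ.^ suc a ℕ.* r) → d ∈ map (p ℕ.*_) (divisors s) ++ divisors r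
  to {d} d∈ with p ∣? d
  ... | yes (divides e refl) = ∈-++⁺ˡ (subst (_∈ map (p ℕ.*_) (divisors s)) (ℕₚ.*-comm p e)
          (∈-map⁺ (p ℕ.*_) (∈-divisors⁺ (*-cancelˡ-∣ p
            (subst₂ _∣_ (ℕₚ.*-comm e p) ps≡ (∈-divisors⁻ {d} d∈))))))
  ... | no p∤d = ∈-++⁺ʳ (map (p ℕ.*_) (divisors s))
          (∈-divisors⁺ (coprime-^-divisor (prime∤⇒coprime pp p∤d) (suc a) (∈-divisors⁻ d∈)))

  from : ∀ {d} → d ∈ map (p ℕ.*_) (divisors s) ++ divisors r → d ∈ divisors (p ℕ.^ suc a ℕ.* r)
  from d∈ with ∈-++⁻ (map (p ℕ.*_) (divisors s)) d∈
  ... | inj₁ ∈map with ∈-map⁻ (p ℕ.*_) ∈map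
  ...   | e , e∈ , refl = ∈-divisors⁺ (subst (p ℕ.* e ∣_) (sym ps≡) (*-monoʳ-∣ p (∈-divisors⁻ e∈)))
  from d∈ | inj₂ d∈r = ∈-divisors⁺ (∣n⇒∣m*n (p ℕ.^ suc a) (∈-divisors⁻ d∈r))

  -- Neither list has repetitions, so having the same members already makes them permutations of
  -- each other, and their sums agree.
  same-elements = unique∧set⇒bag (divisors-unique (p ℕ.^ suc a ℕ.* r)) unique (mk⇔ to from)

-- Splitting off the full power of a prime.

prime-factor : ∀ n .{{_ : NonTrivial n}} → ∃[ p ] Prime p × p ∣ n
prime-factor n = go (factorise n {{ℕ.nonTrivial⇒nonZero n}})
  where
  go : PrimeFactorisation n → ∃[ p ] Prime p × p ∣ n
  go record { factors = [] ; isFactorisation = n≡1 } = contradiction n≡1 (ℕ.nonTrivial⇒≢1 {n})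
  go record { factors = p ∷ ps ; isFactorisation = n≡ ; factorsPrime = pp ∷ _ } =
    p , pp , divides (ℕ.product ps) (trans n≡ (ℕₚ.*-comm p (ℕ.product ps)))

-- Dividing a nonzero number by p makes it strictly smaller, so well-founded recursion reaches a
-- cofactor that p does not divide.
split-prime : ∀ {p} → Prime p → ∀ n .{{_ : NonZero n}} →
              ∃[ a ] ∃[ r ] n ≡ p ℕ.^ a ℕ.* r × ¬ p ∣ r
split-prime {p} pp n {{n≢0}} = <-rec P step n n≢0
  where
  P : ℕ → Set
  P n = .(NonZero n) → ∃[ a ] ∃[ r ] n ≡ p ℕ.^ a ℕ.* r × ¬ p ∣ r
  step : ∀ n → (∀ {m} → m ℕ.< n → P m) → P n
  step n rec n≢0 with p ∣? n
  ... | no p∤n = 0 , n , sym (ℕₚ.*-identityˡ n) , p∤n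
  ... | yes p∣n@(divides s refl) =
    let a , r , s≡ , p∤r = rec (quotient-< p∣n {{prime⇒nonTrivial pp}} {{n≢0}})
                               (ℕₚ.m*n≢0⇒m≢0 s {{n≢0}})
    in suc a , r ,
       trans (ℕₚ.*-comm s p) (trans (cong (p ℕ.*_) s≡) (sym (ℕₚ.*-assoc p (p ℕ.^ a) r))) ,
       p∤r

-- Rational powers and geometric sums.

*-cancelʳ : 0ℚ < w → x * w ≡ y * w → x ≡ y
*-cancelʳ {w} 0<w xw≡yw = ≤-antisym (cancel (≤-reflexive xw≡yw)) (cancel (≤-reflexive (sym xw≡yw)))
  where
  cancel : ∀ {x y} → x * w ≤ y * w → x ≤ y
  cancel = *-cancelʳ-≤-pos w {{positive 0<w}}

1^ : ∀ n → 1ℚ ^ n ≡ 1ℚ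
1^ zero    = refl
1^ (suc n) = trans (*-identityˡ (1ℚ ^ n)) (1^ n)

^-cancel-≤ : 0ℚ ≤ q → ∀ n .{{_ : NonZero n}} → p ^ n ≤ q ^ n → p ≤ q
^-cancel-≤ {q} {p} 0≤q n pⁿ≤qⁿ = [
  (λ q<p → contradiction (<-≤-trans (^-monoˡ-< 0≤q q<p n) pⁿ≤qⁿ) (<-irrefl refl)) ,
  id
  ]′ (connex q p)

^-comm : ∀ x m n → (x ^ m) ^ n ≡ (x ^ n) ^ m
^-comm x m n = trans (^-assocʳ x m n) (trans (cong (x ^_) (ℕₚ.*-comm m n)) (sym (^-assocʳ x n m)))

-- For `w` = 1/p this is I(pᵃ), the sum of p⁻ʲ over j ≤ a.
geom : ℚ → ℕ → ℚ
geom w zero    = 1ℚ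
geom w (suc a) = geom w a + w ^ suc a

geom-closed : ∀ w a → (1ℚ - w) * geom w a ≡ 1ℚ - w ^ suc a
geom-closed w zero    = solve 1 (λ w → (con 1ℚ :- w) :* con 1ℚ := con 1ℚ :- w :* con 1ℚ) refl w
geom-closed w (suc a) = begin
  (1ℚ - w) * (geom w a + w ^ suc a)
    ≡⟨ *-distribˡ-+ (1ℚ - w) (geom w a) (w ^ suc a) ⟩
  (1ℚ - w) * geom w a + (1ℚ - w) * w ^ suc a
    ≡⟨ cong (_+ (1ℚ - w) * w ^ suc a) (geom-closed w a) ⟩
  1ℚ - w ^ suc a + (1ℚ - w) * w ^ suc a
    ≡⟨ solve 2 (λ w W → (con 1ℚ :- W) :+ (con 1ℚ :- w) :* W := con 1ℚ :- w :* W) refl w (w ^ suc a) ⟩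
  1ℚ - w * w ^ suc a  ∎
  where open ≡-Reasoning

geom-mono : 0ℚ ≤ w → ∀ {a} b → a ℕ.≤′ b → geom w a ≤ geom w b
geom-mono 0≤w _ (ℕ.≤′-reflexive refl) = ≤-refl
geom-mono 0≤w (suc b) (ℕ.≤′-step a≤b) =
  ≤-trans (geom-mono 0≤w b a≤b) (≤-by (0≤^ 0≤w (suc b)) refl)

-- This is I(pᵃ) < p/(p - 1) with the denominator cleared; the gap is exactly the positive term
-- `w ^ suc a`.
geom-bound : 0ℚ < w → ∀ a → (1ℚ - w) * geom w a < 1ℚ
geom-bound {w} 0<w a = subst (_< 1ℚ) (sym (geom-closed w a))
  (<-by (0<^ 0<w (suc a)) (solve 1 (λ W → con 1ℚ := (con 1ℚ :- W) :+ W) refl (w ^ suc a)))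

-- Multiplicativity of the abundancy index at a prime.

ι-^ : ∀ m n → ι (m ℕ.^ n) ≡ ι m ^ n
ι-^ m zero    = refl
ι-^ m (suc n) = trans (ι-* m (m ℕ.^ n)) (cong (ι m *_) (ι-^ m n))

I-cong : ∀ {m n} .{{_ : NonZero m}} .{{_ : NonZero n}} → m ≡ n → I m ≡ I n
I-cong refl = refl

0≤I : ∀ n .{{_ : NonZero n}} → 0ℚ ≤ I n
0≤I n = *-cancelʳ-≤-pos (ι n) {{positive (0<ι n)}}
  (subst₂ _≤_ (sym (*-zeroˡ (ι n))) (sym (/-*-ι (σ n) n)) (0≤ι (σ n)))

ι-σ : ∀ {p} → Prime p → ι p * w ≡ 1ℚ → ∀ a {r} .{{_ : NonZero r}} → ¬ p ∣ r →
      ι (σ (p ℕ.^ a ℕ.* r)) ≡ ι p ^ a * (geom w a * ι (σ r))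
ι-σ pp pw≡1 zero {r} p∤r = trans (cong (ι ∘ σ) (ℕₚ.*-identityˡ r))
  (solve 1 (λ s → s := con 1ℚ :* (con 1ℚ :* s)) refl (ι (σ r)))
ι-σ {w} {p} pp pw≡1 (suc a) {r} p∤r = begin
  ι (σ (p ℕ.^ suc a ℕ.* r))                       ≡⟨ cong ι (σ-prime-* pp a p∤r) ⟩
  ι (p ℕ.* σ (p ℕ.^ a ℕ.* r) ℕ.+ σ r)             ≡⟨ ι-+ (p ℕ.* σ (p ℕ.^ a ℕ.* r)) (σ r) ⟩
  ι (p ℕ.* σ (p ℕ.^ a ℕ.* r)) + ι (σ r)           ≡⟨ cong (_+ ι (σ r)) (ι-* p (σ (p ℕ.^ a ℕ.* r))) ⟩
  ι p * ι (σ (p ℕ.^ a ℕ.* r)) + ι (σ r)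
    ≡⟨ cong₂ (λ s t → ι p * s + t) (ι-σ pp pw≡1 a p∤r) (sym (*-identityˡ (ι (σ r)))) ⟩
  ι p * (ι p ^ a * (geom w a * ι (σ r))) + 1ℚ * ι (σ r)
    -- Writing 1 as pᵃ⁺¹wᵃ⁺¹ turns the bare summand σ(r) of the recursion into the new top term of
    -- the geometric sum.
    ≡⟨ cong (λ z → ι p * (ι p ^ a * (geom w a * ι (σ r))) + z * ι (σ r)) (sym P*W≡1) ⟩
  ι p * (ι p ^ a * (geom w a * ι (σ r))) + (ι p ^ suc a * w ^ suc a) * ι (σ r)
    ≡⟨ solve 5 (λ p P g s W → p :* (P :* (g :* s)) :+ (p :* P :* W) :* s := p :* P :* ((g :+ W) :* s))
         refl (ι p) (ι p ^ a) (geom w a) (ι (σ r)) (w ^ suc a) ⟩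
  ι p ^ suc a * (geom w (suc a) * ι (σ r))        ∎
  where
  open ≡-Reasoning
  P*W≡1 : ι p ^ suc a * w ^ suc a ≡ 1ℚ
  P*W≡1 = trans (sym (^-distrib-* (ι p) w (suc a))) (trans (cong (_^ suc a) pw≡1) (1^ (suc a)))

-- Both sides are multiplied by pᵃr, which reduces the claim to `ι-σ`.
I-split : ∀ {p} → Prime p → ι p * w ≡ 1ℚ → ∀ a {r} .{{_ : NonZero r}}
          .{{_ : NonZero (p ℕ.^ a ℕ.* r)}} → ¬ p ∣ r →
          I (p ℕ.^ a ℕ.* r) ≡ geom w a * I r
I-split {w} {p} pp pw≡1 a {r} p∤r = *-cancelʳ (0<ι (p ℕ.^ a ℕ.* r)) (begin
  I (p ℕ.^ a ℕ.* r) * ι (p ℕ.^ a ℕ.* r)     ≡⟨ /-*-ι (σ (p ℕ.^ a ℕ.* r)) (p ℕ.^ a ℕ.* r) ⟩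
  ι (σ (p ℕ.^ a ℕ.* r))                     ≡⟨ ι-σ pp pw≡1 a p∤r ⟩
  ι p ^ a * (geom w a * ι (σ r))            ≡⟨ cong (λ s → ι p ^ a * (geom w a * s)) (/-*-ι (σ r) r) ⟨
  ι p ^ a * (geom w a * (I r * ι r))
    ≡⟨ solve 4 (λ P g i r → P :* (g :* (i :* r)) := (g :* i) :* (P :* r))
         refl (ι p ^ a) (geom w a) (I r) (ι r) ⟩
  geom w a * I r * (ι p ^ a * ι r)
    ≡⟨ cong (geom w a * I r *_) (trans (cong (_* ι r) (sym (ι-^ p a))) (sym (ι-* (p ℕ.^ a) r))) ⟩
  geom w a * I r * ι (p ℕ.^ a ℕ.* r)        ∎)
  where open ≡-Reasoning

-- The inequality between I(p²ᵃ) and I(pᵃ).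

-- Fourth powers make the exponents comparable: y⁴ⁱ ≤ x⁵ⁱ ≤ x⁴ᵐ, the second step because x ≥ 1.
^-compare : 1ℚ ≤ x → 0ℚ ≤ y → y ^ 4 ≤ x ^ 5 → ∀ i m → 5 ℕ.* i ℕ.≤ 4 ℕ.* m → y ^ i ≤ x ^ m
^-compare {x} {y} 1≤x 0≤y y⁴≤x⁵ i m 5i≤4m = ^-cancel-≤ (0≤^ 0≤x m) 4 (begin
  (y ^ i) ^ 4        ≡⟨ ^-comm y i 4 ⟩
  (y ^ 4) ^ i        ≤⟨ ^-monoˡ (0≤^ 0≤y 4) y⁴≤x⁵ i ⟩
  (x ^ 5) ^ i        ≡⟨ ^-assocʳ x 5 i ⟩
  x ^ (5 ℕ.* i)      ≤⟨ ^-monoʳ 1≤x 5i≤4m ⟩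
  x ^ (4 ℕ.* m)      ≡⟨ cong (x ^_) (ℕₚ.*-comm 4 m) ⟩
  x ^ (m ℕ.* 4)      ≡⟨ ^-assocʳ x m 4 ⟨
  (x ^ m) ^ 4        ∎)
  where
  open ≤-Reasoning
  0≤x = ≤-trans 0≤1 1≤x

-- This is c < 4/5 without logarithms. It rests on (4/3)⁵ < (13/9)⁴: if 4m < 5i, then (13/9)⁵ⁱ ≤
-- (4/3)⁵ᵐ < (13/9)⁴ᵐ ≤ (13/9)⁵ⁱ.
exponent-bound : ∀ i m .{{_ : NonZero m}} → (+ 13 / 9) ^ i ≤ (+ 4 / 3) ^ m → 5 ℕ.* i ℕ.≤ 4 ℕ.* m
exponent-bound i m h with 5 ℕ.* i ℕₚ.≤? 4 ℕ.* m
... | yes le = le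
... | no ≰ = contradiction (begin-strict
  B ^ (5 ℕ.* i)   ≡⟨ ^-assocʳ B 5 i ⟨
  (B ^ 5) ^ i     ≡⟨ ^-comm B 5 i ⟩
  (B ^ i) ^ 5     ≤⟨ ^-monoˡ (0≤^ 0≤B i) h 5 ⟩
  (A ^ m) ^ 5     ≡⟨ ^-comm A m 5 ⟩
  (A ^ 5) ^ m     <⟨ ^-monoˡ-< (0≤^ (from-yes (0ℚ ≤? A)) 5) (from-yes (A ^ 5 <? B ^ 4)) m ⟩
  (B ^ 4) ^ m     ≡⟨ ^-assocʳ B 4 m ⟩
  B ^ (4 ℕ.* m)   ≤⟨ ^-monoʳ (from-yes (1ℚ ≤? B)) (ℕₚ.<⇒≤ (ℕₚ.≰⇒> ≰)) ⟩
  B ^ (5 ℕ.* i)   ∎) (<-irrefl refl)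
  where
  open ≤-Reasoning
  A = + 4 / 3
  B = + 13 / 9
  0≤B = from-yes (0ℚ ≤? B)

-- (1 - w)⁴ (1 + w)⁵ = (1 + w) (1 - w²)⁴ ≥ (1 + w) (1 - 4 w²) ≥ 1 for w ≤ 1/5.
^4≤^5 : 0ℚ ≤ w → w ≤ + 1 / 5 → 1ℚ + w ≤ x → 0ℚ ≤ y → (1ℚ - w) * y ≤ 1ℚ → y ^ 4 ≤ x ^ 5
^4≤^5 {w} {x} {y} 0≤w w≤1/5 1+w≤x 0≤y [1-w]y≤1 = begin
  y ^ 4                                     ≡⟨ *-identityˡ (y ^ 4) ⟨
  1ℚ * y ^ 4                                ≤⟨ *-monoʳ (0≤^ 0≤y 4) 1≤ ⟩
  (1ℚ + w) ^ 5 * (1ℚ - w) ^ 4 * y ^ 4       ≡⟨ *-assoc ((1ℚ + w) ^ 5) ((1ℚ - w) ^ 4) (y ^ 4) ⟩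
  (1ℚ + w) ^ 5 * ((1ℚ - w) ^ 4 * y ^ 4)     ≡⟨ cong ((1ℚ + w) ^ 5 *_) (^-distrib-* (1ℚ - w) y 4) ⟨
  (1ℚ + w) ^ 5 * ((1ℚ - w) * y) ^ 4         ≤⟨ *-monoˡ (0≤^ 0≤1+w 5) (^-monoˡ (0≤* 0≤1-w 0≤y) [1-w]y≤1 4) ⟩
  (1ℚ + w) ^ 5 * 1ℚ ^ 4                     ≡⟨ *-identityʳ ((1ℚ + w) ^ 5) ⟩
  (1ℚ + w) ^ 5                              ≤⟨ ^-monoˡ 0≤1+w 1+w≤x 5 ⟩
  x ^ 5                                     ∎
  where
  open ≤-Reasoning
  0≤1+w : 0ℚ ≤ 1ℚ + w
  0≤1+w = 0≤+ 0≤1 0≤w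
  0≤1/5-w = 0≤- w≤1/5
  0≤1-w : 0ℚ ≤ 1ℚ - w
  0≤1-w = 0≤- (≤-trans w≤1/5 (from-yes (+ 1 / 5 ≤? 1ℚ)))
  1≤ : 1ℚ ≤ (1ℚ + w) ^ 5 * (1ℚ - w) ^ 4
  1≤ = ≤-by
    -- With u = w², the excess over 1 is w(1 - 4w - 4w²) + (1 + w)u²(6 - 4u + u²). The first bracket
    -- equals 1/25 at w = 1/5 and is expanded around that point; the second is 2 + (2 - u)².
    (0≤+ (0≤* 0≤w (0≤+ (from-yes (0ℚ ≤? + 1 / 25))
           (0≤* 0≤1/5-w (0≤+ (from-yes (0ℚ ≤? + 24 / 5)) (0≤* (from-yes (0ℚ ≤? ι 4)) 0≤w)))))
         (0≤* 0≤1+w (0≤* (0≤² (w * w)) (0≤+ (from-yes (0ℚ ≤? ι 2)) (0≤² (ι 2 - w * w))))))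
    (solve 1 (λ w → let 1+w = con 1ℚ :+ w ; 1-w = con 1ℚ :- w ; u = w :* w in
        (1+w :* (1+w :* (1+w :* (1+w :* (1+w :* con 1ℚ))))) :* (1-w :* (1-w :* (1-w :* (1-w :* con 1ℚ))))
      := con 1ℚ :+ (w :* (con (+ 1 / 25) :+ (con (+ 1 / 5) :- w) :* (con (+ 24 / 5) :+ con (ι 4) :* w))
           :+ 1+w :* ((u :* u) :* (con (ι 2) :+ (con (ι 2) :- u) :* (con (ι 2) :- u))))) refl w)

1/p≤1/5 : ∀ p .{{_ : NonZero p}} → 5 ℕ.≤ p → + 1 / p ≤ + 1 / 5
1/p≤1/5 p 5≤p = *-cancelʳ-≤-pos (ι p) {{positive (0<ι p)}}
  (subst (_≤ + 1 / 5 * ι p) (sym (/-*-ι 1 p)) (*-monoˡ (from-yes (0ℚ ≤? + 1 / 5)) (ι-mono 5≤p)))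

0<1/p : ∀ p .{{_ : NonZero p}} → 0ℚ < + 1 / p
0<1/p p = </-ι 1 p (subst (_< ι 1) (sym (*-zeroˡ (ι p))) 0<1)

1≤geom : 0ℚ ≤ w → ∀ a → 1ℚ ≤ geom w a
1≤geom 0≤w a = geom-mono 0≤w a ℕₚ.z≤′n

-- The hypothesis on `i` and `m` expresses i/m ≤ c in integer powers, so the claim is I(p²ᵃ)ᶜ ≤
-- I(pᵃ) with c replaced by a rational at most c.
geom-ineq : ∀ i m .{{_ : NonZero m}} → (+ 13 / 9) ^ i ≤ (+ 4 / 3) ^ m →
  ∀ p .{{_ : NonZero p}} → Prime p → p ≢ 2 →
  ∀ a → geom (+ 1 / p) (a ℕ.* 2) ^ i ≤ geom (+ 1 / p) a ^ m
geom-ineq i m h p pp p≢2 zero = ≤-reflexive (trans (1^ i) (sym (1^ m)))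
geom-ineq _ _ h 1 pp p≢2 (suc a) = contradiction pp ¬prime[1]
geom-ineq _ _ h 2 pp p≢2 (suc a) = contradiction refl p≢2
-- Here I(3) = 4/3 and I(9) = 13/9: the tight case is the hypothesis itself.
geom-ineq _ _ h 3 pp p≢2 1 = h
-- From a = 2 on, I(3ᵃ) ≥ I(9) = 13/9, while I(3²ᵃ) stays below the infinite sum 3/2; (3/2)⁴ ≤
-- (13/9)⁵ is then enough.
geom-ineq i m h 3 pp p≢2 (suc (suc a)) = ^-compare (1≤geom 0≤w (2 ℕ.+ a)) 0≤B (begin
    B ^ 4           ≤⟨ ^-monoˡ 0≤B B≤3/2 4 ⟩
    (+ 3 / 2) ^ 4   ≤⟨ from-yes ((+ 3 / 2) ^ 4 ≤? (+ 13 / 9) ^ 5) ⟩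
    (+ 13 / 9) ^ 5  ≤⟨ ^-monoˡ (from-yes (0ℚ ≤? + 13 / 9))
                         (geom-mono 0≤w (2 ℕ.+ a) (ℕₚ.≤⇒≤′ (ℕ.s≤s (ℕ.s≤s ℕ.z≤n)))) 5 ⟩
    A ^ 5           ∎) i m (exponent-bound i m h)
  where
  open ≤-Reasoning
  A = geom (+ 1 / 3) (2 ℕ.+ a)
  B = geom (+ 1 / 3) ((2 ℕ.+ a) ℕ.* 2)
  0≤w = from-yes (0ℚ ≤? + 1 / 3)
  0≤B : 0ℚ ≤ B
  0≤B = ≤-trans 0≤1 (1≤geom 0≤w ((2 ℕ.+ a) ℕ.* 2))
  B≤3/2 : B ≤ + 3 / 2
  B≤3/2 = subst₂ _≤_ (solve 1 (λ y → con (+ 3 / 2) :* ((con 1ℚ :- con (+ 1 / 3)) :* y) := y) refl B) refl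
    (*-monoˡ {+ 3 / 2} (from-yes (0ℚ ≤? + 3 / 2))
      (<⇒≤ (geom-bound (from-yes (0ℚ <? + 1 / 3)) ((2 ℕ.+ a) ℕ.* 2))))
geom-ineq _ _ h 4 pp p≢2 (suc a) = contradiction pp (from-no (prime? 4))
-- For p ≥ 5 the first two terms 1 + 1/p bound I(pᵃ) from below, and the infinite sum bounds I(p²ᵃ)
-- from above.
geom-ineq i m h p@(suc (suc (suc (suc (suc _))))) pp p≢2 (suc a) =
  ^-compare (1≤geom 0≤w (suc a)) 0≤y
    (^4≤^5 0≤w (1/p≤1/5 p (ℕ.s≤s (ℕ.s≤s (ℕ.s≤s (ℕ.s≤s (ℕ.s≤s ℕ.z≤n))))))
      (subst (_≤ geom v (suc a)) (cong (_+_ 1ℚ) (*-identityʳ v))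
        (geom-mono 0≤w (suc a) (ℕₚ.≤⇒≤′ (ℕ.s≤s ℕ.z≤n))))
      0≤y (<⇒≤ (geom-bound (0<1/p p) (suc a ℕ.* 2))))
    i m (exponent-bound i m h)
  where
  v = + 1 / p
  0≤w = <⇒≤ (0<1/p p)
  0≤y = ≤-trans 0≤1 (1≤geom 0≤w (suc a ℕ.* 2))

-- Passage from prime powers to odd n.

prime∤² : ∀ {p} → Prime p → ∀ {r} → ¬ p ∣ r → ¬ p ∣ r ℕ.^ 2
prime∤² {p} pp {r} p∤r p∣r² =
  [ p∤r , p∤r ∘ subst (p ∣_) (ℕₚ.*-identityʳ r) ]′ (euclidsLemma r (r ℕ.* 1) pp p∣r²)

[m*n]² : ∀ m n → (m ℕ.* n) ℕ.^ 2 ≡ m ℕ.^ 2 ℕ.* n ℕ.^ 2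
[m*n]² = expand
  where
  expand : ∀ m n → m ℕ.* n ℕ.* (m ℕ.* n ℕ.* 1) ≡ m ℕ.* (m ℕ.* 1) ℕ.* (n ℕ.* (n ℕ.* 1))
  expand = solve-∀

-- Strong induction: n = pᵃr with p ∤ r gives n² = p²ᵃr², so both indices factor. `geom-ineq`
-- handles the prime power and the induction hypothesis handles r, which is odd as a divisor of n
-- and differs from n because p ∣ n.
I[n²]ⁱ≤I[n]ᵐ : ∀ i m .{{_ : NonZero m}} → (+ 13 / 9) ^ i ≤ (+ 4 / 3) ^ m →
  ∀ n .{{_ : NonZero n}} .{{_ : NonZero (n ℕ.^ 2)}} → ¬ 2 ∣ n → I (n ℕ.^ 2) ^ i ≤ I n ^ m
I[n²]ⁱ≤I[n]ᵐ i m h n = <-rec P step n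
  where
  P : ℕ → Set
  P n = .{{_ : NonZero n}} .{{_ : NonZero (n ℕ.^ 2)}} → ¬ 2 ∣ n → I (n ℕ.^ 2) ^ i ≤ I n ^ m
  step : ∀ n → (∀ {r} → r ℕ.< n → P r) → P n
  step 1 _ _ = ≤-reflexive (trans (1^ i) (sym (1^ m)))
  step n@(suc (suc _)) rec 2∤n = go (prime-factor n)
    where
    go : ∃[ p ] Prime p × p ∣ n → I (n ℕ.^ 2) ^ i ≤ I n ^ m
    go (p , pp , p∣n) = go′ (split-prime pp n)
      where
      go′ : ∃[ a ] ∃[ r ] n ≡ p ℕ.^ a ℕ.* r × ¬ p ∣ r → I (n ℕ.^ 2) ^ i ≤ I n ^ m
      go′ (a , r , n≡ , p∤r) = begin
        I (n ℕ.^ 2) ^ i                            ≡⟨ cong (_^ i) (I-cong n²≡) ⟩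
        I (p ℕ.^ (a ℕ.* 2) ℕ.* r ℕ.^ 2) ^ i        ≡⟨ cong (_^ i) (I-split pp pv≡1 (a ℕ.* 2) (prime∤² pp p∤r)) ⟩
        (geom v (a ℕ.* 2) * I (r ℕ.^ 2)) ^ i       ≡⟨ ^-distrib-* (geom v (a ℕ.* 2)) (I (r ℕ.^ 2)) i ⟩
        geom v (a ℕ.* 2) ^ i * I (r ℕ.^ 2) ^ i     ≤⟨ *-mono (0≤^ (0≤geom (a ℕ.* 2)) i) (0≤^ (0≤I r) m)
                                                       (geom-ineq i m h p pp p≢2 a) (rec r<n 2∤r) ⟩
        geom v a ^ m * I r ^ m                     ≡⟨ ^-distrib-* (geom v a) (I r) m ⟨
        (geom v a * I r) ^ m                       ≡⟨ cong (_^ m) (I-split pp pv≡1 a p∤r) ⟨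
        I (p ℕ.^ a ℕ.* r) ^ m                      ≡⟨ cong (_^ m) (I-cong n≡) ⟨
        I n ^ m                                    ∎
        where
        open ≤-Reasoning
        r∣n : r ∣ n
        r∣n = subst (r ∣_) (sym n≡) (∣n⇒∣m*n (p ℕ.^ a) ∣-refl)
        2∤r : ¬ 2 ∣ r
        2∤r 2∣r = 2∤n (∣-trans 2∣r r∣n)
        p≢2 : p ≢ 2
        p≢2 refl = 2∤n p∣n
        r<n : r ℕ.< n
        r<n = ℕₚ.≤∧≢⇒< (∣⇒≤ r∣n) λ { refl → p∤r p∣n }
        n²≡ : n ℕ.^ 2 ≡ p ℕ.^ (a ℕ.* 2) ℕ.* r ℕ.^ 2
        n²≡ = trans (cong (ℕ._^ 2) n≡) (trans ([m*n]² (p ℕ.^ a) r)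
                (cong (ℕ._* r ℕ.^ 2) (ℕₚ.^-*-assoc p a 2)))
        instance
          p≢0 = prime⇒nonZero pp
          r≢0 : NonZero r
          r≢0 = ℕ.≢-nonZero λ { refl → p∤r (p ∣0) }
          r²≢0 = ℕₚ.m^n≢0 r 2
          pᵃr≢0 = ℕₚ.m*n≢0 (p ℕ.^ a) r {{ℕₚ.m^n≢0 p a}}
          p²ᵃr²≢0 = ℕₚ.m*n≢0 (p ℕ.^ (a ℕ.* 2)) (r ℕ.^ 2) {{ℕₚ.m^n≢0 p (a ℕ.* 2)}}
        v = + 1 / p
        pv≡1 : ι p * v ≡ 1ℚ
        pv≡1 = trans (*-comm (ι p) v) (/-*-ι 1 p)
        0≤geom : ∀ a → 0ℚ ≤ geom v a
        0≤geom a = ≤-trans 0≤1 (1≤geom (<⇒≤ (0<1/p p)) a)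

-- From Darboux sums of logarithms to integer powers.

-- Repeating the ratios of a partition for x yields a partition for xⁿ.
repeat : ℕ → List ℚ → List ℚ
repeat n rs = concat (replicate n rs)

repeat⁺ : ∀ n {rs} → All (0ℚ <_) rs → All (0ℚ <_) (repeat n rs)
repeat⁺ zero    _    = []
repeat⁺ (suc n) 0<rs = ++⁺ 0<rs (repeat⁺ n 0<rs)

product-repeat : ∀ n rs → product (repeat n rs) ≡ product rs ^ n
product-repeat zero    rs = refl
product-repeat (suc n) rs = trans (product-++ rs (repeat n rs)) (cong (product rs *_) (product-repeat n rs))

sum-map-repeat : ∀ (f : ℚ → ℚ) n rs → sum (map f (repeat n rs)) ≡ ι n * sum (map f rs)
sum-map-repeat f zero    rs = sym (*-zeroˡ (sum (map f rs)))
sum-map-repeat f (suc n) rs = begin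
  sum (map f (rs ++ repeat n rs))                 ≡⟨ cong sum (map-++ f rs (repeat n rs)) ⟩
  sum (map f rs ++ map f (repeat n rs))           ≡⟨ sum-++ (map f rs) (map f (repeat n rs)) ⟩
  sum (map f rs) + sum (map f (repeat n rs))      ≡⟨ cong (_+_ (sum (map f rs))) (sum-map-repeat f n rs) ⟩
  sum (map f rs) + ι n * sum (map f rs)
    ≡⟨ solve 2 (λ s n → s :+ n :* s := (con 1ℚ :+ n) :* s) refl (sum (map f rs)) (ι n) ⟩
  ι (suc n) * sum (map f rs)                      ∎
  where
  open ≡-Reasoning

-- If xᵐ < yⁱ, inserting the inverse ratio v = xᵐ / yⁱ < 1 turns the lower sum for xᵐ into a larger
-- one for yⁱ, against the upper sum for yⁱ.
ln-ratio : ∀ i m .{{_ : NonZero m}} → 0ℚ < x → LowerLn x p → UpperLn y q →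
           + i / m * q < p → y ^ i ≤ x ^ m
ln-ratio {x} {p} {y} {q} i m 0<x (us , 0<us , Πus*x≡1 , p<S) (rs , 0<rs , refl , T<q) iq/m<p =
  [ (λ xᵐ<yⁱ → contradiction (excess xᵐ<yⁱ (inverse (0<^ (0<product 0<rs) i))) (<-irrefl refl)) ,
    id
  ]′ (connex (x ^ m) (y ^ i))
  where
  open ≤-Reasoning
  S = lowerSum us
  T = upperSum rs
  iT<mS : ι i * T < ι m * S
  iT<mS = begin-strict
    ι i * T                ≤⟨ *-monoˡ (0≤ι i) (<⇒≤ T<q) ⟩
    ι i * q                ≡⟨ cong (_* q) (/-*-ι i m) ⟨
    + i / m * ι m * q      ≡⟨ solve 3 (λ t m q → t :* m :* q := t :* q :* m) refl (+ i / m) (ι m) q ⟩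
    + i / m * q * ι m      <⟨ *-monoʳ-< (0<ι m) iq/m<p ⟩
    p * ι m                <⟨ *-monoʳ-< (0<ι m) p<S ⟩
    S * ι m                ≡⟨ *-comm S (ι m) ⟩
    ι m * S                ∎
  excess : x ^ m < y ^ i → ∃[ z ] 0ℚ < z × y ^ i * z ≡ 1ℚ → ι i * T < ι i * T
  excess xᵐ<yⁱ (z , 0<z , yⁱz≡1) = begin-strict
    ι i * T                        <⟨ iT<mS ⟩
    ι m * S                        ≡⟨ sum-map-repeat (λ u → 1ℚ - u) m us ⟨
    lowerSum (repeat m us)         <⟨ <-by (0<- v<1) (+-comm (1ℚ - v) (lowerSum (repeat m us))) ⟩
    lowerSum (v ∷ repeat m us)     ≤⟨ lowerSum≤upperSum (0<* (0<^ 0<x m) 0<z ∷ repeat⁺ m 0<us)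
                                        (repeat⁺ i 0<rs) Π≡1 ⟩
    upperSum (repeat i rs)         ≡⟨ sum-map-repeat (λ r → r - 1ℚ) i rs ⟩
    ι i * T                        ∎
    where
    v = x ^ m * z
    v<1 : v < 1ℚ
    v<1 = subst (v <_) yⁱz≡1 (*-monoʳ-< 0<z xᵐ<yⁱ)
    -- The three blocks contribute xᵐ/yⁱ, x⁻ᵐ and yⁱ, so the lower and upper sums are comparable.
    Π≡1 : v * product (repeat m us) * product (repeat i rs) ≡ 1ℚ
    Π≡1 = begin-equality
      v * product (repeat m us) * product (repeat i rs)
        ≡⟨ cong₂ (λ s t → v * s * t) (product-repeat m us) (product-repeat i rs) ⟩
      x ^ m * z * product us ^ m * y ^ i
        ≡⟨ solve 4 (λ X z U Y → X :* z :* U :* Y := (U :* X) :* (Y :* z))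
             refl (x ^ m) z (product us ^ m) (y ^ i) ⟩
      product us ^ m * x ^ m * (y ^ i * z)
        ≡⟨ cong₂ _*_ (trans (sym (^-distrib-* (product us) x m))
                          (trans (cong (_^ m) Πus*x≡1) (1^ m))) yⁱz≡1 ⟩
      1ℚ * 1ℚ  ∎

-- Rational approximation of roots and of the exponent.

-- One Newton step for tᵐ = p, started at x with m = k + 1. By Bernoulli the power lies above its
-- tangent at x, so the point where the tangent takes the value p still has m-th power at least p.
root-approx : 0ℚ ≤ p → 0ℚ ≤ x → ∀ k → p < x ^ suc k → ∃[ v ] 0ℚ ≤ v × v < x × p ≤ v ^ suc k
root-approx {p} {x} 0≤p 0≤x k p<xᵐ = [
  (λ 0<x → go 0<x (inverse (0<* (0<^ 0<x k) (0<ι (suc k))))) ,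
  (λ x≤0 → contradiction (≤-<-trans 0≤p (<-≤-trans p<xᵐ
     (subst (x ^ suc k ≤_) (*-zeroˡ (0ℚ ^ k)) (^-monoˡ 0≤x x≤0 (suc k))))) (<-irrefl refl))
  ]′ (connex 0ℚ x)
  where
  open ≤-Reasoning
  go : 0ℚ < x → ∃[ w ] 0ℚ < w × x ^ k * ι (suc k) * w ≡ 1ℚ → ∃[ v ] 0ℚ ≤ v × v < x × p ≤ v ^ suc k
  go 0<x (w , 0<w , cw≡1) =
    x - ε , 0≤- ε≤x , <-by 0<ε (solve 2 (λ x ε → x := (x :- ε) :+ ε) refl x ε) , (begin
    p
      ≡⟨ solve 2 (λ p X → p := X :- con 1ℚ :* (X :- p)) refl p (x ^ suc k) ⟩
    x ^ suc k - 1ℚ * (x ^ suc k - p)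
      ≡⟨ cong (λ z → x ^ suc k - z * (x ^ suc k - p)) cw≡1 ⟨
    x ^ suc k - (x ^ k * ι (suc k) * w) * (x ^ suc k - p)
      ≡⟨ solve 5 (λ x X n w g → x :* X :- (X :* n :* w) :* g := X :* (x :+ n :* ((x :- g :* w) :- x)))
           refl x (x ^ k) (ι (suc k)) w (x ^ suc k - p) ⟩
    x ^ k * (x + ι (suc k) * ((x - ε) - x))        ≤⟨ bernoulli 0≤x (0≤- ε≤x) k ⟩
    (x - ε) ^ suc k                                ∎)
    where
    -- The Newton correction: `w` is the inverse of the derivative (k + 1)xᵏ.
    ε = (x ^ suc k - p) * w
    0<ε : 0ℚ < ε
    0<ε = 0<* (0<- p<xᵐ) 0<w
    ε≤x : ε ≤ x
    ε≤x = begin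
      (x ^ suc k - p) * w
        ≤⟨ *-monoʳ {p = x ^ suc k - p} (<⇒≤ 0<w)
             (≤-by 0≤p (solve 2 (λ X p → X := (X :- p) :+ p) refl (x ^ suc k) p)) ⟩
      x ^ suc k * w
        ≤⟨ ≤-by (0≤* (0≤ι k) (0≤* (0≤^ 0≤x (suc k)) (<⇒≤ 0<w)))
             (solve 4 (λ x X n w → x :* (X :* (con 1ℚ :+ n) :* w)
                                     := (x :* X) :* w :+ n :* ((x :* X) :* w))
               refl x (x ^ k) (ι k) w) ⟩
      x * (x ^ k * ι (suc k) * w)     ≡⟨ trans (cong (x *_) cw≡1) (*-identityʳ x) ⟩
      x                               ∎

bernoulli₁ : 1ℚ ≤ x → ∀ m → 1ℚ + ι m * (x - 1ℚ) ≤ x ^ m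
bernoulli₁ {x} 1≤x zero = ≤-reflexive (trans (cong (_+_ 1ℚ) (*-zeroˡ (x - 1ℚ))) (+-identityʳ 1ℚ))
bernoulli₁ {x} 1≤x (suc m) = subst (_≤ x ^ suc m)
  (trans (cong (_* (1ℚ + ι (suc m) * (x - 1ℚ))) (1^ m)) (*-identityˡ (1ℚ + ι (suc m) * (x - 1ℚ))))
  (bernoulli 0≤1 (≤-trans 0≤1 1≤x) m)

-- With r = x / b the claim is x² < rⁱ⁺²; as c is bounded below, i + 2 grows with the denominator,
-- so Bernoulli's inequality applies.
exponents : ∀ {b} → 1ℚ ≤ b → b < x → (c : ℝ) → Pos c →
  ∃[ k ] ∃[ i ] L c (+ i / suc k) × U c (+ (2 ℕ.+ i) / suc k) × b ^ (2 ℕ.+ i) < x ^ i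
exponents {x} {b} 1≤b b<x c 0<c = go (inverse 0<b) (ℝ.L-open c 0<c)
  where
  open ≤-Reasoning
  0<b = <-≤-trans 0<1 1≤b
  go : ∃[ w ] 0ℚ < w × b * w ≡ 1ℚ → ∃[ d ] 0ℚ < d × L c d →
    ∃[ k ] ∃[ i ] L c (+ i / suc k) × U c (+ (2 ℕ.+ i) / suc k) × b ^ (2 ℕ.+ i) < x ^ i
  -- A positive rational d < c forces i + 2 > d(k + 1), so the denominator k + 1 is chosen with x² <
  -- (k + 1)d(r - 1).
  go (w , 0<w , bw≡1) (d , 0<d , d∈L) = pick (archimedean′ (x * x) (0<* 0<d (0<- 1<r)))
    where
    r = x * w
    1<r : 1ℚ < r
    1<r = subst (_< r) bw≡1 (*-monoʳ-< 0<w b<x)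
    br≡x : b * r ≡ x
    br≡x = trans (solve 3 (λ b x w → b :* (x :* w) := x :* (b :* w)) refl b x w)
      (trans (cong (x *_) bw≡1) (*-identityʳ x))
    0<x = <-trans 0<b b<x
    pick : ∃[ k ] x * x < ι (suc k) * (d * (r - 1ℚ)) →
      ∃[ k ] ∃[ i ] L c (+ i / suc k) × U c (+ (2 ℕ.+ i) / suc k) × b ^ (2 ℕ.+ i) < x ^ i
    pick (k , x²<) =
      let i , i∈L , i+2∈U = trap c 0<c (suc k)
      in k , i , i∈L , i+2∈U , bound i (ℝ.L<U c d∈L i+2∈U)
      where
      bound : ∀ i → d < + (2 ℕ.+ i) / suc k → b ^ (2 ℕ.+ i) < x ^ i
      bound i d< = *-cancelʳ-< (<⇒≤ (0<* 0<x 0<x)) (begin-strict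
        b ^ (2 ℕ.+ i) * (x * x)
          ≡⟨ *-comm (b ^ (2 ℕ.+ i)) (x * x) ⟩
        x * x * b ^ (2 ℕ.+ i)
          <⟨ *-monoʳ-< (0<^ 0<b (2 ℕ.+ i)) x²<r ⟩
        r ^ (2 ℕ.+ i) * b ^ (2 ℕ.+ i)
          ≡⟨ *-comm (r ^ (2 ℕ.+ i)) (b ^ (2 ℕ.+ i)) ⟩
        b ^ (2 ℕ.+ i) * r ^ (2 ℕ.+ i)      ≡⟨ ^-distrib-* b r (2 ℕ.+ i) ⟨
        (b * r) ^ (2 ℕ.+ i)                ≡⟨ cong (_^ (2 ℕ.+ i)) br≡x ⟩
        x ^ (2 ℕ.+ i)                      ≡⟨ solve 2 (λ x X → x :* (x :* X) := X :* (x :* x)) refl x (x ^ i) ⟩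
        x ^ i * (x * x)                    ∎)
        where
        x²<r : x * x < r ^ (2 ℕ.+ i)
        x²<r = begin-strict
          x * x                                        <⟨ x²< ⟩
          ι (suc k) * (d * (r - 1ℚ))
            ≡⟨ solve 3 (λ k d s → k :* (d :* s) := (d :* k) :* s) refl (ι (suc k)) d (r - 1ℚ) ⟩
          d * ι (suc k) * (r - 1ℚ)                     <⟨ *-monoʳ-< (0<- 1<r) (*-monoʳ-< (0<ι (suc k)) d<) ⟩
          + (2 ℕ.+ i) / suc k * ι (suc k) * (r - 1ℚ)   ≡⟨ cong (_* (r - 1ℚ)) (/-*-ι (2 ℕ.+ i) (suc k)) ⟩
          ι (2 ℕ.+ i) * (r - 1ℚ)                       ≤⟨ ≤-by 0≤1 (+-comm 1ℚ (ι (2 ℕ.+ i) * (r - 1ℚ))) ⟩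
          1ℚ + ι (2 ℕ.+ i) * (r - 1ℚ)                  ≤⟨ bernoulli₁ (<⇒≤ 1<r) (2 ℕ.+ i) ⟩
          r ^ (2 ℕ.+ i)                                ∎

-- The bound for I(n²) and the conclusion.

I-perfect : ∀ {N} .{{_ : NonZero N}} → Perfect N → I N ≡ ι 2
I-perfect {N} σN≡2N = *-cancelʳ (0<ι N) (trans (/-*-ι (σ N) N) (trans (cong ι σN≡2N) (ι-* 2 N)))

5≤q : ∀ {q} → Prime q → q % 4 ≡ 1 → 5 ℕ.≤ q
5≤q {1} pq _ = contradiction pq ¬prime[1]
5≤q {suc (suc (suc (suc (suc q))))} _ _ = ℕ.s≤s (ℕ.s≤s (ℕ.s≤s (ℕ.s≤s (ℕ.s≤s ℕ.z≤n))))

-- As q ≥ 5, (4/5) I(qᵏ) ≤ (1 - 1/q) I(qᵏ) < 1. With I(n²) ≤ 8/5 the product I(qᵏ) I(n²), which is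
-- 2, would fall below 2.
8/5<I[n²] : ∀ {N q k n} .{{_ : NonZero n}} .{{_ : NonZero (n ℕ.^ 2)}} →
           Perfect N → EulerianForm N q k n → + 8 / 5 < I (n ℕ.^ 2)
8/5<I[n²] {N} {q} {k} {n} σN≡2N
  record { N≡qᵏn² = refl ; q-prime = pq ; q%4≡1 = q%4≡1 ; gcd≡1 = gcd≡1 } =
  [ id , (λ X≤8/5 → contradiction (tooSmall X≤8/5) (<-irrefl refl)) ]′ (connex (+ 8 / 5) X)
  where
  open ≤-Reasoning
  X = I (n ℕ.^ 2)
  q∤n : ¬ q ∣ n
  q∤n q∣n = ¬prime[1] (subst Prime (gcd≡1⇒coprime gcd≡1 (∣-refl , q∣n)) pq)
  instance
    q≢0 = prime⇒nonZero pq
    N≢0 = ℕₚ.m*n≢0 (q ℕ.^ k) (n ℕ.^ 2) {{ℕₚ.m^n≢0 q k}}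
  v = + 1 / q
  G = geom v k
  0≤G : 0ℚ ≤ G
  0≤G = ≤-trans 0≤1 (1≤geom (<⇒≤ (0<1/p q)) k)
  GX≡2 : G * X ≡ ι 2
  GX≡2 = trans (sym (I-split pq (trans (*-comm (ι q) v) (/-*-ι 1 q)) k (prime∤² pq q∤n)))
    (I-perfect {N} σN≡2N)
  4/5G<1 : + 4 / 5 * G < 1ℚ
  4/5G<1 = ≤-<-trans (*-monoʳ {p = + 4 / 5} 0≤G (≤-by (0≤- (1/p≤1/5 q (5≤q pq q%4≡1)))
    (solve 1 (λ v → con 1ℚ :- v := con (+ 4 / 5) :+ (con (+ 1 / 5) :- v)) refl v))) (geom-bound (0<1/p q) k)
  tooSmall : X ≤ + 8 / 5 → ι 2 < ι 2
  tooSmall X≤8/5 = begin-strict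
    ι 2                     ≡⟨ GX≡2 ⟨
    G * X                   ≤⟨ *-monoˡ 0≤G X≤8/5 ⟩
    G * (+ 8 / 5)           ≡⟨ solve 1 (λ G → G :* con (+ 8 / 5) := (con (+ 4 / 5) :* G) :* con (ι 2)) refl G ⟩
    + 4 / 5 * G * ι 2       <⟨ *-monoʳ-< (0<ι 2) 4/5G<1 ⟩
    1ℚ * ι 2                ≡⟨ *-identityˡ (ι 2) ⟩
    ι 2                     ∎

theorem1 : (N q k n : ℕ) .{{_ : NonZero n}} → OddPerfect N → EulerianForm N q k n →
    power (+ 8 / 5) 1≤8/5
    (quotient (ln (+ 4 / 3)) (ln (+ 13 / 9)) 0<ln[4/3] 0<ln[13/9])
    0<ln[4/3]/ln[13/9]
    <ᵣ fromℚ (I n)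
theorem1 N q k n (N%2≡1 , perfect) form =
  go (exponents 1≤8/5 (8/5<I[n²] perfect form) c 0<ln[4/3]/ln[13/9])
  where
  c = quotient (ln (+ 4 / 3)) (ln (+ 13 / 9)) 0<ln[4/3] 0<ln[13/9]
  instance
    n²≢0 = ℕₚ.m^n≢0 n 2
  2∤n : ¬ 2 ∣ n
  2∤n 2∣n = contradiction (trans (sym N%2≡1) (n∣m⇒m%n≡0 N 2 2∣N)) λ ()
    where
    2∣N : 2 ∣ N
    2∣N = subst (2 ∣_) (sym (EulerianForm.N≡qᵏn² form)) (∣n⇒∣m*n (q ℕ.^ k) (∣m⇒∣m*n (n ℕ.* 1) 2∣n))
  go : ∃[ l ] ∃[ i ] L c (+ i / suc l) × U c (+ (2 ℕ.+ i) / suc l) ×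
         (+ 8 / 5) ^ (2 ℕ.+ i) < I (n ℕ.^ 2) ^ i →
       power (+ 8 / 5) 1≤8/5 c 0<ln[4/3]/ln[13/9] <ᵣ fromℚ (I n)
  -- Membership of i/m in the lower cut of c, for m = l + 1, unfolds to rationals a < ln (4/3) and b
  -- > ln (13/9) with (i/m)b < a, the input of `ln-ratio`.
  go (l , i , (_ , _ , a∈L , b∈U , ib/m<a) , i+2∈U , [8/5]^[2+i]<Xⁱ) =
    -- The upper cut of `power` wants v with (8/5)ⁱ⁺² ≤ vᵐ. Strictness of (8/5)ⁱ⁺² < I(n)ᵐ lets v
    -- lie strictly below I(n), leaving room for the separating rational `s`.
    let v , 0≤v , v<I , lb = root-approx (0≤^ (≤-trans 0≤1 1≤8/5) (2 ℕ.+ i)) (0≤I n) l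
          (<-≤-trans [8/5]^[2+i]<Xⁱ
            (I[n²]ⁱ≤I[n]ᵐ i (suc l)
              (ln-ratio i (suc l) (from-yes (0ℚ <? + 4 / 3)) a∈L b∈U ib/m<a) n 2∤n))
        s , v<s , s<I = <-dense v<I
    in s , (v , v<s , 0≤v , 2 ℕ.+ i , suc l , _ , i+2∈U , lb) , s<I
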